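{- For every $\varepsilon>0$ there exists $W_0$ such that the following holds. If $W\ge W_0$ and $\mathcal{A}$ is a non-empty bridge-alterable class of graphs on the vertex set $\{1,\ldots,W\}$, and $\mathbf{G}$ is a uniformly random element of $\mathcal{A}$, then \[ \mathbf{P}(\mathbf{G}\text{ is connected})\ \ge\ (1-\varepsilon)\,e^{ -1/2}. \]
   Context: Graphs are finite, simple and labelled. A bridge in a graph $G$ is an edge $e$ such that $G-e$ has strictly more connected components than $G$. A set $\mathcal{A}$ of graphs on the vertex set $\{1,\ldots,W\}$ is bridge-alterable if for every graph $G$ on $\{1,\ldots,W\}$ and every bridge $e$ of $G$, we have $G\in\mathcal{A}$ if and only if $G-e\in\mathcal{A}$. -}

module Defs where

open import Data.Bool using (Bool; true; false; _∧_; _∨_; not; if_then_else_)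
open import Data.Nat as ℕ using (ℕ; zero; suc; _<ᵇ_)
open import Data.Integer using (+_; -[1+_])
open import Data.Fin using (Fin; toℕ; _≟_)
open import Data.Vec using (Vec; []; _∷_; lookup; tabulate)
open import Data.List using (List; []; _∷_; [_]; map; concatMap; length; filterᵇ; allFin)
open import Data.Bool.ListAction using (all; any)
open import Data.Rational using (ℚ; _/_; 0ℚ; 1ℚ; _+_; _*_; _≤_)
open import Data.Product using (_×_)
open import Data.Sum using (_⊎_)
open import Relation.Nullary.Decidable using (⌊_⌋)

-- A graph on the vertex set Fin W (= {1,…,W}) is given by its adjacency matrix;
-- only simple (irreflexive, symmetric) matrices count as graphs.
Graph : ℕ → Set
Graph W = Vec (Vec Bool W) W

adj : ∀ {W} → Graph W → Fin W → Fin W → Bool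
adj G i j = lookup (lookup G i) j

_==_ : Bool → Bool → Bool
true == b = b
false == b = not b

allᶠ : ∀ {W} → (Fin W → Bool) → Bool
allᶠ {W} p = all p (allFin W)

anyᶠ : ∀ {W} → (Fin W → Bool) → Bool
anyᶠ {W} p = any p (allFin W)

isSimple : ∀ {W} → Graph W → Bool
isSimple G = allᶠ λ i → allᶠ λ j → not (adj G i i) ∧ (adj G i j == adj G j i)

allVecs : ∀ {A : Set} → List A → (n : ℕ) → List (Vec A n)
allVecs xs zero = [ [] ]
allVecs xs (suc n) = concatMap (λ x → map (x ∷_) (allVecs xs n)) xs

simpleGraphs : (W : ℕ) → List (Graph W)
simpleGraphs W = filterᵇ isSimple (allVecs (allVecs (true ∷ false ∷ []) W) W)

reachWithin : ∀ {W} → ℕ → Graph W → Fin W → Fin W → Bool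
reachWithin zero G u v = ⌊ u ≟ v ⌋
reachWithin (suc k) G u v = reachWithin k G u v ∨ anyᶠ (λ w → reachWithin k G u w ∧ adj G w v)

-- u and v lie in the same connected component (paths have < W edges)
reachable : ∀ {W} → Graph W → Fin W → Fin W → Bool
reachable {W} G = reachWithin W G

isConnected : ∀ {W} → Graph W → Bool
isConnected G = allᶠ λ u → allᶠ λ v → reachable G u v

-- number of connected components = number of vertices that are the
-- least vertex of their component
components : ∀ {W} → Graph W → ℕ
components {W} G =
  length (filterᵇ (λ v → allᶠ (λ w → not (reachable G v w ∧ (toℕ w <ᵇ toℕ v)))) (allFin W))

deleteEdge : ∀ {W} → Graph W → Fin W → Fin W → Graph W
deleteEdge G u v = tabulate λ i → tabulate λ j →
  adj G i j ∧ not ((⌊ i ≟ u ⌋ ∧ ⌊ j ≟ v ⌋) ∨ (⌊ i ≟ v ⌋ ∧ ⌊ j ≟ u ⌋))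

IsBridge : ∀ {W} → Graph W → Fin W → Fin W → Set
IsBridge G u v = (adj G u v ≡ true) × (components G ℕ.< components (deleteEdge G u v))
  where open import Relation.Binary.PropositionalEquality using (_≡_)

-- a class of graphs on Fin W, as a (decidable) subset; only its values on
-- simple graphs matter
Class : ℕ → Set
Class W = Graph W → Bool

open import Relation.Binary.PropositionalEquality using (_≡_)

BridgeAlterable : ∀ {W} → Class W → Set
BridgeAlterable {W} 𝒜 = (G : Graph W) → isSimple G ≡ true → (u v : Fin W) →
  IsBridge G u v → 𝒜 G ≡ 𝒜 (deleteEdge G u v)

NonEmpty : ∀ {W} → Class W → Set
NonEmpty {W} 𝒜 = Data.Product.Σ (Graph W) λ G → (isSimple G ≡ true) × (𝒜 G ≡ true)
  where import Data.Product

size : ∀ {W} → Class W → ℕ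
size {W} 𝒜 = length (filterᵇ 𝒜 (simpleGraphs W))

connectedCount : ∀ {W} → Class W → ℕ
connectedCount {W} 𝒜 = length (filterᵇ (λ G → 𝒜 G ∧ isConnected G) (simpleGraphs W))

ratio : ℕ → ℕ → ℚ
ratio c zero = 0ℚ
ratio c (suc n) = (+ c) / suc n

probConnected : ∀ {W} → Class W → ℚ
probConnected 𝒜 = ratio (connectedCount 𝒜) (size 𝒜)

invFact : ℕ → ℚ
invFact zero = 1ℚ
invFact (suc k) = invFact k * ((+ 1) / suc k)

expNeg1Partial : ℕ → ℚ
expNeg1Partial zero = 1ℚ
expNeg1Partial (suc n) = expNeg1Partial n + (sign (suc n) * invFact (suc n))
  where
  sign : ℕ → ℚ
  sign zero = 1ℚ
  sign (suc zero) = -[1+ 0 ] / 1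
  sign (suc (suc k)) = sign k

-- a · e^{-1/2} ≤ p   (correct for p ≥ 0, the only case used).
-- The odd partial sums t(2n+1) increase to e^{-1}, so for a > 0, p ≥ 0:
-- a e^{-1/2} ≤ p  ⇔  a² e^{-1} ≤ p²  ⇔  ∀ n, a² t(2n+1) ≤ p².
_·e^-½≤_ : ℚ → ℚ → Set
a ·e^-½≤ p = (a ≤ 0ℚ) ⊎ ((0ℚ ≤ p) × (∀ n → a * a * expNeg1Partial (suc (n ℕ.+ n)) ≤ p * p))

{-# OPTIONS --safe #-}
module Submission where

-- Let F_j be the number of graphs in 𝒜 with j components. Everything rests on 2jW F_{j+1} ≤ (W + 5j) F_j.
-- Since 𝒜 is bridge-alterable, pairs (G with j components, bridge xy of G) correspond to pairs
-- (H with j+1 components, x and y in different components) via H = G − xy. Weight each component U by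
-- D/|U| and write |U| = w, with m bridges in U, so m ≤ w − 1. Bounding 1 by |A| − (bridges in A) for one of
-- two components A, B of H, the terms |A| turn into bridges of G; the terms with a bridge of A turn, after
-- deleting that bridge too, into triples of separated vertices in graphs with j+2 components, which by
-- symmetry count the pairs of bridges of G lying in one component. So 2jW D F_{j+1} is at most the sum
-- over G and U of (D/w)(2mw + 4m − m(m−1)), and 2mw − m² ≤ w².
--
-- If 5M ≤ W this gives F_{j+1} ≤ F_1 C(M+j, j)/(2M)^j, so by the negative binomial series
-- |𝒜| ≤ F_1 (1 − 1/(2M))^{-(M+1)}. With q = 2M − 1 and Y = q/(q+1), the probability p satisfies p² ≥ Y^{q+3}.
-- Finally t ≤ Y^q for every odd partial sum t of the series of e^{-1}: the polynomial
-- T(x) = Σ_{i≤2n+1} (−x)^i/i! is convex on [0,1], so (1+h) T(x+h) ≤ T(x), which is used q times with h = 1/q.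

open import Defs
open import Data.Bool using (Bool; T; true; false; _∧_; _∨_; not; _xor_)
open import Data.Bool.Properties using (∧-comm; ∧-identityʳ; ∧-zeroʳ)
open import Data.Bool.ListAction using (all; any)
open import Data.Nat as ℕ using (_!; _^_; ℕ; zero; suc; _+_; _*_; _≤_; _≥_; z≤n; s≤s; _<ᵇ_; _≡ᵇ_)
open import Data.Nat.Properties hiding (_≟_)
open import Data.Nat.DivMod using (m/n*n≡m)
open import Data.Nat.Divisibility using (∣-trans; m∣m*n; m≤n⇒m!∣n!)
open import Data.Nat.Tactic.RingSolver using (solve-∀)
open import Data.Fin using (Fin; fromℕ<; zero; suc; toℕ; _≟_)
open import Data.Fin.Properties using (toℕ-injective)
open import Data.Vec using (Vec; []; _∷_; lookup; updateAt)
open import Data.Vec.Properties using (lookup∘updateAt; lookup∘updateAt′; lookup∘tabulate)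
open import Data.List using (List; []; _∷_; map; concatMap; length; filterᵇ; allFin; _++_)
import Data.List as List
open import Data.Product using (∃; _×_; _,_; proj₁; proj₂)
open import Data.Sum using (_⊎_; inj₁; inj₂)
open import Data.Empty using (⊥; ⊥-elim)
open import Function using (_∘_; id)
open import Relation.Nullary using (yes; no; ¬_)
open import Relation.Nullary.Decidable using (⌊_⌋)
open import Relation.Binary.PropositionalEquality using (_≡_; _≢_; refl; sym; trans; cong; cong₂; subst; subst₂; module ≡-Reasoning)
open import Data.Integer as ℤ using (-[1+_])
import Data.Integer.Properties as ℤP
open import Data.Rational as ℚ using (ℚ; mkℚ; 0ℚ; 1ℚ; _<_; _-_; _/_; toℚᵘ) renaming (_+_ to _+ℚ_; _*_ to _*ℚ_; _≤_ to _≤ℚ_)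
import Data.Rational.Properties as ℚP
open ℚP using (toℚᵘ-fromℚᵘ; toℚᵘ-cancel-≤; toℚᵘ-injective; toℚᵘ-homo-*; toℚᵘ-homo-+)
open import Data.Rational.Solver using (module +-*-Solver)
open import Data.Rational.Unnormalised using (mkℚᵘ; *≤*) renaming (_≃_ to _≃ᵘ_)
import Data.Rational.Unnormalised.Properties as ℚᵘP

-- The weights gain the factor 2. If A and B are the components of H joined by xy, the weight of
-- their union in G is D/(|A| + |B|), and its multiple by |A| + |B| is D again; so the sum of |B| D
-- over ordered pairs (A, B) is jWD whatever the component sizes are. The two estimates, 1 ≤ |A| -
-- (bridges in A) and 2mw - m² ≤ w², are sharp to leading order for forests, where m = w - 1; the
-- lower-order remainder is what becomes 5j.
--
-- The number of pairs of bridges has no useful bound of its own in a general class. It is never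
-- bounded: it occurs on both sides as the same sum over triples and cancels.
--
-- All counts are of ordered pairs, so a component with m bridges contributes 2m, and m ≤ w - 1
-- takes the form 2m + 2 ≤ 2w. Taking D = W! keeps every weight an integer, so the combinatorial
-- part stays in ℕ.

private variable
  A B : Set
  W : ℕ

-- Booleans

⇔→≡ : ∀ {a b} → (a ≡ true → b ≡ true) → (b ≡ true → a ≡ true) → a ≡ b
⇔→≡ {false} {false} _ _ = refl
⇔→≡ {false} {true}  _ g = g refl
⇔→≡ {true}  {false} f _ = sym (f refl)
⇔→≡ {true}  {true}  _ _ = refl

true≢false : ∀ {b} → b ≡ true → b ≢ false
true≢false refl ()

¬true→false : ∀ {b} → ¬ (b ≡ true) → b ≡ false
¬true→false {true}  h = ⊥-elim (h refl)
¬true→false {false} h = refl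

∧-split : ∀ {a b} → a ∧ b ≡ true → (a ≡ true) × (b ≡ true)
∧-split {true} {true} _ = refl , refl

∧-intro : ∀ {a b} → a ≡ true → b ≡ true → a ∧ b ≡ true
∧-intro refl refl = refl

∨-split : ∀ {a b} → a ∨ b ≡ true → (a ≡ true) ⊎ (b ≡ true)
∨-split {true}  _ = inj₁ refl
∨-split {false} e = inj₂ e

∨-introʳ : ∀ a {b} → b ≡ true → a ∨ b ≡ true
∨-introʳ true  _ = refl
∨-introʳ false e = e

not-true : ∀ {b} → not b ≡ true → b ≡ false
not-true {false} _ = refl

all-tabulate⁻ : ∀ {n} (p : A → Bool) (f : Fin n → A) → all p (List.tabulate f) ≡ true → ∀ i → p (f i) ≡ true
all-tabulate⁻ p f e zero    = proj₁ (∧-split e)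
all-tabulate⁻ p f e (suc i) = all-tabulate⁻ p (f ∘ suc) (proj₂ (∧-split {p (f zero)} e)) i

all-tabulate⁺ : ∀ {n} (p : A → Bool) (f : Fin n → A) → (∀ i → p (f i) ≡ true) → all p (List.tabulate f) ≡ true
all-tabulate⁺ {n = zero}  p f h = refl
all-tabulate⁺ {n = suc n} p f h = ∧-intro (h zero) (all-tabulate⁺ p (f ∘ suc) (h ∘ suc))

any-tabulate⁻ : ∀ {n} (p : A → Bool) (f : Fin n → A) → any p (List.tabulate f) ≡ true → ∃ λ i → p (f i) ≡ true
any-tabulate⁻ {n = suc n} p f e with ∨-split {p (f zero)} e
... | inj₁ h = zero , h
... | inj₂ h with any-tabulate⁻ p (f ∘ suc) h
...   | i , q = suc i , q

any-tabulate⁺ : ∀ {n} (p : A → Bool) (f : Fin n → A) i → p (f i) ≡ true → any p (List.tabulate f) ≡ true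
any-tabulate⁺ p f zero    e rewrite e = refl
any-tabulate⁺ p f (suc i) e = ∨-introʳ (p (f zero)) (any-tabulate⁺ p (f ∘ suc) i e)

allᶠ⁻ : (p : Fin W → Bool) → allᶠ p ≡ true → ∀ i → p i ≡ true
allᶠ⁻ p = all-tabulate⁻ p id

allᶠ⁺ : (p : Fin W → Bool) → (∀ i → p i ≡ true) → allᶠ p ≡ true
allᶠ⁺ p = all-tabulate⁺ p id

anyᶠ⁻ : (p : Fin W → Bool) → anyᶠ p ≡ true → ∃ λ i → p i ≡ true
anyᶠ⁻ p = any-tabulate⁻ p id

anyᶠ⁺ : (p : Fin W → Bool) → ∀ i → p i ≡ true → anyᶠ p ≡ true
anyᶠ⁺ p = any-tabulate⁺ p id

⌊≟⌋-refl : (i : Fin W) → ⌊ i ≟ i ⌋ ≡ true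
⌊≟⌋-refl i with i ≟ i
... | yes _ = refl
... | no ¬e = ⊥-elim (¬e refl)

⌊≟⌋⇒≡ : {i j : Fin W} → ⌊ i ≟ j ⌋ ≡ true → i ≡ j
⌊≟⌋⇒≡ {i = i} {j} _ with i ≟ j
⌊≟⌋⇒≡ _  | yes e = e
⌊≟⌋⇒≡ () | no _

≢⇒⌊≟⌋ : {i j : Fin W} → i ≢ j → ⌊ i ≟ j ⌋ ≡ false
≢⇒⌊≟⌋ h = ¬true→false (h ∘ ⌊≟⌋⇒≡)

-- Finite sums

𝟙 : Bool → ℕ
𝟙 true  = 1
𝟙 false = 0

∑ : List A → (A → ℕ) → ℕ
∑ []       f = 0
∑ (x ∷ xs) f = f x + ∑ xs f

infixr 8 ∑
syntax ∑ xs (λ x → e) = ∑[ x ∈ xs ] e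

∑-cong : (xs : List A) {f g : A → ℕ} → (∀ x → f x ≡ g x) → ∑ xs f ≡ ∑ xs g
∑-cong []       h = refl
∑-cong (x ∷ xs) h = cong₂ _+_ (h x) (∑-cong xs h)

∑-mono : (xs : List A) {f g : A → ℕ} → (∀ x → f x ≤ g x) → ∑ xs f ≤ ∑ xs g
∑-mono []       h = z≤n
∑-mono (x ∷ xs) h = +-mono-≤ (h x) (∑-mono xs h)

∑-zero : (xs : List A) → ∑[ x ∈ xs ] 0 ≡ 0
∑-zero []       = refl
∑-zero (x ∷ xs) = ∑-zero xs

∑-+ : (xs : List A) (f g : A → ℕ) → ∑[ x ∈ xs ] (f x + g x) ≡ ∑ xs f + ∑ xs g
∑-+ []       f g = refl
∑-+ (x ∷ xs) f g rewrite ∑-+ xs f g = lem (f x) (g x) (∑ xs f) (∑ xs g)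
  where
  lem : ∀ a b c d → a + b + (c + d) ≡ a + c + (b + d)
  lem = solve-∀

∑-*ˡ : (xs : List A) (c : ℕ) (f : A → ℕ) → ∑[ x ∈ xs ] (c * f x) ≡ c * ∑ xs f
∑-*ˡ []       c f = sym (*-zeroʳ c)
∑-*ˡ (x ∷ xs) c f rewrite ∑-*ˡ xs c f = sym (*-distribˡ-+ c (f x) (∑ xs f))

∑-*ʳ : (xs : List A) (c : ℕ) (f : A → ℕ) → ∑[ x ∈ xs ] (f x * c) ≡ ∑ xs f * c
∑-*ʳ xs c f = trans (∑-cong xs (λ x → *-comm (f x) c)) (trans (∑-*ˡ xs c f) (*-comm c _))

∑-swap : (xs : List A) (ys : List B) (f : A → B → ℕ) →
  ∑[ x ∈ xs ] ∑[ y ∈ ys ] f x y ≡ ∑[ y ∈ ys ] ∑[ x ∈ xs ] f x y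
∑-swap []       ys f = sym (∑-zero ys)
∑-swap (x ∷ xs) ys f = trans (cong (∑ ys (f x) +_) (∑-swap xs ys f)) (sym (∑-+ ys (f x) _))

∑-++ : (xs ys : List A) (f : A → ℕ) → ∑ (xs ++ ys) f ≡ ∑ xs f + ∑ ys f
∑-++ []       ys f = refl
∑-++ (x ∷ xs) ys f = trans (cong (f x +_) (∑-++ xs ys f)) (sym (+-assoc (f x) _ _))

∑-map : (h : A → B) (xs : List A) (f : B → ℕ) → ∑ (map h xs) f ≡ ∑ xs (f ∘ h)
∑-map h []       f = refl
∑-map h (x ∷ xs) f = cong (f (h x) +_) (∑-map h xs f)

∑-concatMap : (h : A → List B) (xs : List A) (f : B → ℕ) →
  ∑ (concatMap h xs) f ≡ ∑[ x ∈ xs ] ∑ (h x) f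
∑-concatMap h []       f = refl
∑-concatMap h (x ∷ xs) f = trans (∑-++ (h x) (concatMap h xs) f) (cong (∑ (h x) f +_) (∑-concatMap h xs f))

length-filterᵇ : (p : A → Bool) (xs : List A) → length (filterᵇ p xs) ≡ ∑[ x ∈ xs ] 𝟙 (p x)
length-filterᵇ p []       = refl
length-filterᵇ p (x ∷ xs) with p x
... | true  = cong suc (length-filterᵇ p xs)
... | false = length-filterᵇ p xs

∑-filterᵇ : (p : A → Bool) (xs : List A) (f : A → ℕ) → ∑ (filterᵇ p xs) f ≡ ∑[ x ∈ xs ] (𝟙 (p x) * f x)
∑-filterᵇ p []       f = refl
∑-filterᵇ p (x ∷ xs) f with p x
... | true  = cong₂ _+_ (sym (+-identityʳ (f x))) (∑-filterᵇ p xs f)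
... | false = ∑-filterᵇ p xs f

guard : ∀ b {m n} → (b ≡ true → m ≡ n) → 𝟙 b * m ≡ 𝟙 b * n
guard true  h = cong (_+ 0) (h refl)
guard false h = refl

guard-≤ : ∀ b {m n} → (b ≡ true → m ≤ n) → 𝟙 b * m ≤ 𝟙 b * n
guard-≤ true  h = +-monoˡ-≤ 0 (h refl)
guard-≤ false h = z≤n

𝟙-∧ : ∀ a b → 𝟙 (a ∧ b) ≡ 𝟙 a * 𝟙 b
𝟙-∧ true  b = sym (+-identityʳ (𝟙 b))
𝟙-∧ false b = refl

𝟙-not : ∀ b → 𝟙 b + 𝟙 (not b) ≡ 1
𝟙-not true  = refl
𝟙-not false = refl

∑-tabulate-zero : ∀ {n} (t : Fin n → A) (f : A → ℕ) → (∀ i → f (t i) ≡ 0) → ∑ (List.tabulate t) f ≡ 0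
∑-tabulate-zero {n = zero}  t f h = refl
∑-tabulate-zero {n = suc n} t f h = cong₂ _+_ (h zero) (∑-tabulate-zero (t ∘ suc) f (h ∘ suc))

∑-tabulate-single : ∀ {n} (t : Fin n → A) (f : A → ℕ) i → (∀ k → k ≢ i → f (t k) ≡ 0) →
  ∑ (List.tabulate t) f ≡ f (t i)
∑-tabulate-single t f zero h =
  trans (cong (f (t zero) +_) (∑-tabulate-zero (t ∘ suc) f (λ k → h (suc k) (λ ())))) (+-identityʳ _)
∑-tabulate-single t f (suc i) h =
  cong₂ _+_ (h zero (λ ())) (∑-tabulate-single (t ∘ suc) f i (λ k k≢i → h (suc k) (λ { refl → k≢i refl })))

∑ⱽ : (Fin W → ℕ) → ℕ
∑ⱽ {W} f = ∑ (allFin W) f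

syntax ∑ⱽ (λ x → e) = ∑ⱽ[ x ] e
infixr 8 ∑ⱽ

∑ⱽ-single : (f : Fin W → ℕ) (i : Fin W) → (∀ k → k ≢ i → f k ≡ 0) → ∑ⱽ f ≡ f i
∑ⱽ-single = ∑-tabulate-single id

∑-tabulate-const : ∀ {n} (t : Fin n → A) (c : ℕ) → ∑[ x ∈ List.tabulate t ] c ≡ n * c
∑-tabulate-const {n = zero}  t c = refl
∑-tabulate-const {n = suc n} t c = cong (c +_) (∑-tabulate-const (t ∘ suc) c)

∑ⱽ-const : (c : ℕ) → ∑ⱽ {W} (λ _ → c) ≡ W * c
∑ⱽ-const {W} = ∑-tabulate-const {n = W} id

∑-tabulate-≥ : ∀ {n} (t : Fin n → A) (f : A → ℕ) i → f (t i) ≤ ∑ (List.tabulate t) f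
∑-tabulate-≥ t f zero    = m≤m+n _ _
∑-tabulate-≥ t f (suc i) = ≤-trans (∑-tabulate-≥ (t ∘ suc) f i) (m≤n+m _ (f (t zero)))

∑ⱽ-≥ : (f : Fin W → ℕ) (i : Fin W) → f i ≤ ∑ⱽ f
∑ⱽ-≥ = ∑-tabulate-≥ id

allᶠ-cong : {p q : Fin W → Bool} → (∀ i → p i ≡ q i) → allᶠ p ≡ allᶠ q
allᶠ-cong {p = p} {q} h = ⇔→≡ (λ e → allᶠ⁺ q (λ i → trans (sym (h i)) (allᶠ⁻ p e i)))
                              (λ e → allᶠ⁺ p (λ i → trans (h i) (allᶠ⁻ q e i)))

≡true⇒T : ∀ {b} → b ≡ true → T b
≡true⇒T refl = _

T⇒≡true : ∀ {b} → T b → b ≡ true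
T⇒≡true {true} _ = refl

-- Boolean equivalence relations on the vertices

record Equiv (r : Fin W → Fin W → Bool) : Set where
  field
    self : ∀ u → r u u ≡ true
    symm : ∀ u v → r u v ≡ r v u
    tran : ∀ {u v} → r u v ≡ true → ∀ z → r u z ≡ r v z

  tranʳ : ∀ {u v} → r u v ≡ true → ∀ z → r z u ≡ r z v
  tranʳ {u} {v} e z = trans (symm z u) (trans (tran e z) (symm v z))

classSize : (Fin W → Fin W → Bool) → Fin W → ℕ
classSize r x = ∑ⱽ[ v ] 𝟙 (r x v)

isLeast : (Fin W → Fin W → Bool) → Fin W → Bool
isLeast r v = allᶠ (λ w → not (r v w ∧ (toℕ w <ᵇ toℕ v)))

classCount : (Fin W → Fin W → Bool) → ℕ
classCount r = ∑ⱽ[ v ] 𝟙 (isLeast r v)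

module _ {r : Fin W → Fin W → Bool} (E : Equiv r) where
  open Equiv E

  isLeast⇒≤ : ∀ {v u} → isLeast r v ≡ true → r v u ≡ true → toℕ v ≤ toℕ u
  isLeast⇒≤ {v} {u} l e = ≮⇒≥ λ u<v →
    true≢false (∧-intro e (T⇒≡true (<⇒<ᵇ u<v))) (not-true (allᶠ⁻ _ l u))

  -- Descent: as long as the class has a vertex below `x`, pass to it. `n` exceeds the label of the
  -- current vertex and bounds the number of moves.
  ∃-least : ∀ n x → toℕ x ℕ.< n → ∃ λ a → (r x a ≡ true) × (isLeast r a ≡ true)
  ∃-least (suc n) x (s≤s x≤n) with anyᶠ (λ w → r x w ∧ (toℕ w <ᵇ toℕ x)) in eq
  ... | false = x , self x , allᶠ⁺ {W} _ (λ w → cong not (¬true→false λ e → true≢false (anyᶠ⁺ (λ w → r x w ∧ (toℕ w <ᵇ toℕ x)) w e) eq))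
  ... | true with anyᶠ⁻ _ eq
  ...   | w , p with ∃-least n w (≤-trans (<ᵇ⇒< _ _ (≡true⇒T (proj₂ (∧-split {r x w} p)))) x≤n)
  ...     | a , wa , la = a , trans (tran (proj₁ (∧-split p)) a) wa , la

  -- Every class has exactly one least vertex. Inserting this factor 1 is what turns a sum over
  -- vertices into a sum over classes.
  ∑-least : ∀ x → ∑ⱽ[ v ] (𝟙 (r x v) * 𝟙 (isLeast r v)) ≡ 1
  ∑-least x with ∃-least (suc (toℕ x)) x ≤-refl
  ... | a , xa , la = trans (∑ⱽ-single _ a other) (cong₂ (λ b c → 𝟙 b * 𝟙 c) xa la)
    where
    other : ∀ k → k ≢ a → 𝟙 (r x k) * 𝟙 (isLeast r k) ≡ 0
    other k k≢a with r x k in xk | isLeast r k in lk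
    ... | false | _     = refl
    ... | true  | false = refl
    ... | true  | true  = ⊥-elim (k≢a (toℕ-injective (≤-antisym
            (isLeast⇒≤ lk (trans (sym (tran xk a)) xa))
            (isLeast⇒≤ la (trans (sym (tran xa k)) xk)))))

  -- Insert `∑-least` for each `x`, exchange the sums, and move `f` to the representative `u`. Only
  -- `f` has to be constant on classes; `h` is later the bridge degree, which is not.
  ∑-by-class : (h f : Fin W → ℕ) → (∀ {x y} → r x y ≡ true → f x ≡ f y) →
    ∑ⱽ[ x ] (h x * f x) ≡ ∑ⱽ[ u ] (𝟙 (isLeast r u) * ((∑ⱽ[ x ] (𝟙 (r u x) * h x)) * f u))
  ∑-by-class h f cf = begin
    ∑ⱽ[ x ] (h x * f x)
      ≡⟨ ∑-cong V (λ x → trans (sym (*-identityʳ _)) (trans (cong (h x * f x *_) (sym (∑-least x)))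
           (sym (∑-*ˡ V (h x * f x) _)))) ⟩
    ∑ⱽ[ x ] ∑ⱽ[ u ] (h x * f x * (𝟙 (r x u) * 𝟙 (isLeast r u)))
      ≡⟨ ∑-swap V V _ ⟩
    ∑ⱽ[ u ] ∑ⱽ[ x ] (h x * f x * (𝟙 (r x u) * 𝟙 (isLeast r u)))
      ≡⟨ ∑-cong V (λ u → trans (∑-cong V (λ x → step x u)) (trans (∑-*ˡ V (𝟙 (isLeast r u)) _)
           (cong (𝟙 (isLeast r u) *_) (∑-*ʳ V (f u) _)))) ⟩
    ∑ⱽ[ u ] (𝟙 (isLeast r u) * ((∑ⱽ[ x ] (𝟙 (r u x) * h x)) * f u)) ∎
    where
    open ≡-Reasoning
    V = allFin W
    lem₁ : ∀ a b c d → a * b * (c * d) ≡ c * (a * b * d)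
    lem₁ = solve-∀
    lem₂ : ∀ a b c d → c * (a * b * d) ≡ d * (c * a * b)
    lem₂ = solve-∀
    step : ∀ x u → h x * f x * (𝟙 (r x u) * 𝟙 (isLeast r u)) ≡ 𝟙 (isLeast r u) * (𝟙 (r u x) * h x * f u)
    step x u = begin
      h x * f x * (𝟙 (r x u) * 𝟙 (isLeast r u))    ≡⟨ lem₁ (h x) (f x) (𝟙 (r x u)) _ ⟩
      𝟙 (r x u) * (h x * f x * 𝟙 (isLeast r u))
        ≡⟨ guard (r x u) (λ e → cong (λ z → h x * z * 𝟙 (isLeast r u)) (cf e)) ⟩
      𝟙 (r x u) * (h x * f u * 𝟙 (isLeast r u))    ≡⟨ cong (λ b → 𝟙 b * (h x * f u * 𝟙 (isLeast r u))) (symm x u) ⟩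
      𝟙 (r u x) * (h x * f u * 𝟙 (isLeast r u))    ≡⟨ lem₂ (h x) (f u) (𝟙 (r u x)) _ ⟩
      𝟙 (isLeast r u) * (𝟙 (r u x) * h x * f u)    ∎

  ∑-classes : (f : Fin W → ℕ) → (∀ {x y} → r x y ≡ true → f x ≡ f y) →
    ∑ⱽ f ≡ ∑ⱽ[ u ] (𝟙 (isLeast r u) * (classSize r u * f u))
  ∑-classes f cf = trans (∑-cong V (λ x → sym (*-identityˡ (f x)))) (trans (∑-by-class (λ _ → 1) f cf)
    (∑-cong V (λ u → cong (λ z → 𝟙 (isLeast r u) * (z * f u)) (∑-cong V (λ x → *-identityʳ _)))))
    where V = allFin W

  classSize-cong : ∀ {x y} → r x y ≡ true → classSize r x ≡ classSize r y
  classSize-cong e = ∑-cong (allFin W) (λ v → cong 𝟙 (tran e v))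

  classSize≥1 : ∀ x → 1 ≤ classSize r x
  classSize≥1 x = ≤-trans (≤-reflexive (cong 𝟙 (sym (self x)))) (∑ⱽ-≥ (λ v → 𝟙 (r x v)) x)

  ∑-classSize : ∑ⱽ[ u ] (𝟙 (isLeast r u) * classSize r u) ≡ W
  ∑-classSize = trans (∑-cong (allFin W) (λ u → cong (𝟙 (isLeast r u) *_) (sym (*-identityʳ _))))
    (trans (sym (∑-classes (λ _ → 1) (λ _ → refl))) (trans (∑ⱽ-const {W} 1) (*-identityʳ W)))

  ∑-otherLeast : ∀ b → classCount r ≡ suc (∑ⱽ[ a ] (𝟙 (isLeast r a) * 𝟙 (not (r b a))))
  ∑-otherLeast b = trans (∑-cong (allFin W) (λ a → split (isLeast r a) (r b a)))
    (trans (∑-+ (allFin W) _ _) (cong (_+ (∑ⱽ[ a ] (𝟙 (isLeast r a) * 𝟙 (not (r b a))))) (∑-least b)))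
    where
    split : ∀ l e → 𝟙 l ≡ 𝟙 e * 𝟙 l + 𝟙 l * 𝟙 (not e)
    split false false = refl
    split false true  = refl
    split true  false = refl
    split true  true  = refl

-- Joining two classes of an equivalence relation

record Merge {W} (r r′ : Fin W → Fin W → Bool) (x y : Fin W) : Set where
  field
    equiv    : Equiv r
    equiv′   : Equiv r′
    separate : r x y ≡ false
    joined   : ∀ v → r′ x v ≡ r x v ∨ r y v
    other    : ∀ v → r′ x v ≡ false → ∀ u → r′ v u ≡ r v u

  disjoint : ∀ {v} → r x v ≡ true → r y v ≡ true → ⊥
  disjoint {v} p q = true≢false (trans (E.tranʳ q x) p) separate
    where module E = Equiv equiv

  𝟙-joined : ∀ v → 𝟙 (r′ x v) ≡ 𝟙 (r x v) + 𝟙 (r y v)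
  𝟙-joined v rewrite joined v with r x v in p | r y v in q
  ... | true  | true  = ⊥-elim (disjoint p q)
  ... | true  | false = refl
  ... | false | true  = refl
  ... | false | false = refl

  𝟙-notJoined : ∀ v → 𝟙 (not (r′ x v)) ≡ 𝟙 (not (r x v)) * 𝟙 (not (r y v))
  𝟙-notJoined v rewrite joined v with r x v | r y v
  ... | true  | _     = refl
  ... | false | true  = refl
  ... | false | false = refl

  classSize-joined : classSize r′ x ≡ classSize r x + classSize r y
  classSize-joined = trans (∑-cong (allFin W) 𝟙-joined) (∑-+ (allFin W) _ _)

  classSize-other : ∀ v → r′ x v ≡ false → classSize r′ v ≡ classSize r v
  classSize-other v e = ∑-cong (allFin W) (λ u → cong 𝟙 (other v e u))

  -- The joined class contains two least vertices for `r` and one for `r′`. Outside it the two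
  -- relations have the same rows, and being least depends only on the row.
  classCount-merge : classCount r ≡ suc (classCount r′)
  classCount-merge = begin
    classCount r
      ≡⟨ ∑-cong V (λ v → split (𝟙 (r x v)) (𝟙 (r y v)) (𝟙-joined v) (𝟙-not (r′ x v)) (𝟙 (isLeast r v))) ⟩
    ∑ⱽ[ v ] ((𝟙 (r x v) * 𝟙 (isLeast r v) + 𝟙 (r y v) * 𝟙 (isLeast r v)) + 𝟙 (not (r′ x v)) * 𝟙 (isLeast r v))
      ≡⟨ trans (∑-+ V _ _) (cong (_+ outside r) (trans (∑-+ V _ _) (cong₂ _+_ (∑-least equiv x) (∑-least equiv y)))) ⟩
    2 + outside r
      ≡⟨ cong (2 +_) (∑-cong V (λ v → guard (not (r′ x v)) (λ e → cong 𝟙 (allᶠ-cong λ w →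
           cong (λ b → not (b ∧ _)) (sym (other v (not-true e) w)))))) ⟩
    2 + outside r′
      ≡⟨ cong suc (cong (_+ outside r′) (∑-least equiv′ x)) ⟨
    suc ((∑ⱽ[ v ] (𝟙 (r′ x v) * 𝟙 (isLeast r′ v))) + outside r′)
      ≡⟨ cong suc (∑-+ V _ _) ⟨
    suc (∑ⱽ[ v ] (𝟙 (r′ x v) * 𝟙 (isLeast r′ v) + 𝟙 (not (r′ x v)) * 𝟙 (isLeast r′ v)))
      ≡⟨ cong suc (∑-cong V (λ v → trans (sym (*-distribʳ-+ _ (𝟙 (r′ x v)) _))
           (trans (cong (_* 𝟙 (isLeast r′ v)) (𝟙-not (r′ x v))) (*-identityˡ _)))) ⟩
    suc (classCount r′) ∎
    where
    open ≡-Reasoning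
    V = allFin W
    outside : (Fin W → Fin W → Bool) → ℕ
    outside s = ∑ⱽ[ v ] (𝟙 (not (r′ x v)) * 𝟙 (isLeast s v))
    lem : ∀ a b n l → (a + b + n) * l ≡ a * l + b * l + n * l
    lem = solve-∀
    split : ∀ a b {j n} → j ≡ a + b → j + n ≡ 1 → ∀ l → l ≡ (a * l + b * l) + n * l
    split a b {n = n} refl e l =
      trans (sym (*-identityˡ l)) (trans (cong (_* l) (sym e)) (lem a b n l))

-- Reachability

data Path (a : Fin W → Fin W → Bool) (u : Fin W) : Fin W → Set where
  []  : Path a u u
  _▷_ : ∀ {v w} → Path a u v → a v w ≡ true → Path a u w

infixl 5 _▷_

module _ {a : Fin W → Fin W → Bool} where
  _▷▷_ : ∀ {u v w} → Path a u v → Path a v w → Path a u w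
  p ▷▷ []      = p
  p ▷▷ (q ▷ e) = (p ▷▷ q) ▷ e

  reverse : (∀ i j → a i j ≡ a j i) → ∀ {u v} → Path a u v → Path a v u
  reverse s []                      = []
  reverse s (_▷_ {v = v} {w} p e) = ([] ▷ trans (s w v) e) ▷▷ reverse s p

  Path-mono : {b : Fin W → Fin W → Bool} → (∀ i j → a i j ≡ true → b i j ≡ true) →
    ∀ {u v} → Path a u v → Path b u v
  Path-mono h []      = []
  Path-mono h (p ▷ e) = Path-mono h p ▷ h _ _ e

∑ⱽ-mono-< : {f g : Fin W → ℕ} → (∀ v → f v ≤ g v) → ∀ i → f i ℕ.< g i → ∑ⱽ f ℕ.< ∑ⱽ g
∑ⱽ-mono-< {W} {f} {g} h i fi<gi = begin
  suc (∑ⱽ f)                               ≡⟨ cong (_+ ∑ⱽ f) (trans (∑ⱽ-single _ i (λ k k≢i → cong 𝟙 (≢⇒⌊≟⌋ k≢i)))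
                                                (cong 𝟙 (⌊≟⌋-refl i))) ⟨
  (∑ⱽ[ v ] 𝟙 ⌊ v ≟ i ⌋) + ∑ⱽ f             ≡⟨ ∑-+ (allFin W) _ f ⟨
  ∑ⱽ[ v ] (𝟙 ⌊ v ≟ i ⌋ + f v)              ≤⟨ ∑-mono (allFin W) step ⟩
  ∑ⱽ g                                     ∎
  where
  open ≤-Reasoning
  step : ∀ v → 𝟙 ⌊ v ≟ i ⌋ + f v ≤ g v
  step v with v ≟ i
  ... | yes refl = fi<gi
  ... | no _     = h v

𝟙≤1 : ∀ b → 𝟙 b ≤ 1
𝟙≤1 true  = ≤-refl
𝟙≤1 false = z≤n

∑ⱽ-𝟙≤W : (p : Fin W → Bool) → ∑ⱽ[ v ] 𝟙 (p v) ≤ W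
∑ⱽ-𝟙≤W {W} p = ≤-trans (∑-mono (allFin W) (λ v → 𝟙≤1 (p v)))
  (≤-reflexive (trans (∑ⱽ-const {W} 1) (*-identityʳ W)))

module _ (G : Graph W) (u : Fin W) where
  reachWithin-sound : ∀ k v → reachWithin k G u v ≡ true → Path (adj G) u v
  reachWithin-sound zero    v e rewrite ⌊≟⌋⇒≡ {i = u} {v} e = []
  reachWithin-sound (suc k) v e with ∨-split {reachWithin k G u v} e
  ... | inj₁ e′ = reachWithin-sound k v e′
  ... | inj₂ e′ with anyᶠ⁻ _ e′
  ...   | w , h = reachWithin-sound k w (proj₁ (∧-split h)) ▷ proj₂ (∧-split {reachWithin k G u w} h)

  reachWithin-suc : ∀ k v → reachWithin k G u v ≡ true → reachWithin (suc k) G u v ≡ true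
  reachWithin-suc k v e rewrite e = refl

  reachWithin-step : ∀ k {v w} → reachWithin k G u v ≡ true → adj G v w ≡ true → reachWithin (suc k) G u w ≡ true
  reachWithin-step k {v} {w} e e′ = ∨-introʳ (reachWithin k G u w) (anyᶠ⁺ (λ z → reachWithin k G u z ∧ adj G z w) v (∧-intro e e′))

  reachWithin-self : ∀ k → reachWithin k G u u ≡ true
  reachWithin-self zero    = ⌊≟⌋-refl u
  reachWithin-self (suc k) = reachWithin-suc k u (reachWithin-self k)

  Closed : ℕ → Set
  Closed k = ∀ {v w} → reachWithin k G u v ≡ true → adj G v w ≡ true → reachWithin k G u w ≡ true

  -- As long as the set reached is not closed under adjacency, each step adds a vertex. At `k = W`
  -- the second alternative would need more than `W` vertices, so `W` steps reach the whole
  -- component.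
  closed-or-large : ∀ k → Closed k ⊎ (k ℕ.< ∑ⱽ[ v ] 𝟙 (reachWithin k G u v))
  closed-or-large zero = inj₂ (≤-trans (≤-reflexive (cong 𝟙 (sym (reachWithin-self 0))))
    (∑ⱽ-≥ (λ v → 𝟙 (reachWithin 0 G u v)) u))
  closed-or-large (suc k) with anyᶠ (λ v → reachWithin (suc k) G u v ∧ not (reachWithin k G u v)) in eq
  ... | false = inj₁ (λ {v} e e′ → reachWithin-step k (old v e) e′)
    where
    old : ∀ v → reachWithin (suc k) G u v ≡ true → reachWithin k G u v ≡ true
    old v e with reachWithin k G u v in e′
    ... | true  = refl
    ... | false = ⊥-elim (true≢false
      (anyᶠ⁺ (λ v → reachWithin (suc k) G u v ∧ not (reachWithin k G u v)) v
        (∧-intro (trans (cong (_∨ anyᶠ (λ w → reachWithin k G u w ∧ adj G w v)) e′) e) (cong not e′))) eq)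
  ... | true with closed-or-large k | anyᶠ⁻ _ eq
  ...   | inj₁ c | v , h = ⊥-elim (true≢false (old (proj₁ (∧-split h))) (not-true (proj₂ (∧-split {reachWithin (suc k) G u v} h))))
    where
    old : reachWithin (suc k) G u v ≡ true → reachWithin k G u v ≡ true
    old e with ∨-split {reachWithin k G u v} e
    ... | inj₁ e′ = e′
    ... | inj₂ e′ with anyᶠ⁻ _ e′
    ...   | w , q = c (proj₁ (∧-split q)) (proj₂ (∧-split {reachWithin k G u w} q))
  ...   | inj₂ l | v , h = inj₂ (≤-<-trans l (∑ⱽ-mono-< mono v (strict _ h)))
    where
    mono : ∀ z → 𝟙 (reachWithin k G u z) ≤ 𝟙 (reachWithin (suc k) G u z)
    mono z with reachWithin k G u z
    ... | true  = ≤-refl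
    ... | false = z≤n
    strict : ∀ a {b} → b ∧ not a ≡ true → 𝟙 a ℕ.< 𝟙 b
    strict false {true} _ = ≤-refl

  reachable-sound : ∀ {v} → reachable G u v ≡ true → Path (adj G) u v
  reachable-sound = reachWithin-sound W _

  reachable-complete : ∀ {v} → Path (adj G) u v → reachable G u v ≡ true
  reachable-complete with closed-or-large W
  ... | inj₂ l = ⊥-elim (<⇒≱ l (∑ⱽ-𝟙≤W _))
  ... | inj₁ c = go
    where
    go : ∀ {v} → Path (adj G) u v → reachable G u v ≡ true
    go []      = reachWithin-self W
    go (p ▷ e) = c (go p) e

record Simple (G : Graph W) : Set where
  field
    irreflexive : ∀ i → adj G i i ≡ false
    symmetric   : ∀ i j → adj G i j ≡ adj G j i

==⇒≡ : ∀ {a b} → (a == b) ≡ true → a ≡ b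
==⇒≡ {true}  e = sym e
==⇒≡ {false} e = sym (not-true e)

==-refl : ∀ a → (a == a) ≡ true
==-refl true  = refl
==-refl false = refl

isSimple⇒Simple : (G : Graph W) → isSimple G ≡ true → Simple G
isSimple⇒Simple G e = record
  { irreflexive = λ i → not-true (proj₁ (∧-split (both i i)))
  ; symmetric   = λ i j → ==⇒≡ (proj₂ (∧-split {not (adj G i i)} (both i j))) }
  where
  both : ∀ i j → not (adj G i i) ∧ (adj G i j == adj G j i) ≡ true
  both i j = allᶠ⁻ _ (allᶠ⁻ (λ i → allᶠ λ j → not (adj G i i) ∧ (adj G i j == adj G j i)) e i) j

Simple⇒isSimple : {G : Graph W} → Simple G → isSimple G ≡ true
Simple⇒isSimple {G = G} s = allᶠ⁺ _ λ i → allᶠ⁺ _ λ j →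
  ∧-intro (cong not (irreflexive i)) (trans (cong (adj G i j ==_) (symmetric j i)) (==-refl (adj G i j)))
  where open Simple s

reachable-equiv : {G : Graph W} → Simple G → Equiv (reachable G)
reachable-equiv {G = G} s = record
  { self = λ u → reachable-complete G u []
  ; symm = λ u v → ⇔→≡ (flip u v) (flip v u)
  ; tran = λ {u} {v} e z → ⇔→≡
      (λ f → reachable-complete G v (reachable-sound G v (flip u v e) ▷▷ reachable-sound G u f))
      (λ f → reachable-complete G u (reachable-sound G u e ▷▷ reachable-sound G v f)) }
  where
  flip : ∀ u v → reachable G u v ≡ true → reachable G v u ≡ true
  flip u v e = reachable-complete G v (reverse (Simple.symmetric s) (reachable-sound G u e))

-- Toggling an edge

isPair : Fin W → Fin W → Fin W → Fin W → Bool
isPair x y i j = ⌊ i ≟ x ⌋ ∧ ⌊ j ≟ y ⌋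

toggleArc : Fin W → Fin W → Graph W → Graph W
toggleArc x y G = updateAt G x (λ row → updateAt row y not)

-- A flip instead of a deletion: it is an involution on all matrices, so adding and removing an edge
-- become one change of variable. For `x = y` the two arc flips cancel, so simplicity is preserved
-- for every `x` and `y`.
toggle : Fin W → Fin W → Graph W → Graph W
toggle x y G = toggleArc x y (toggleArc y x G)

adj-toggleArc : ∀ x y (G : Graph W) i j → adj (toggleArc x y G) i j ≡ isPair x y i j xor adj G i j
adj-toggleArc x y G i j with i ≟ x
... | no i≢x = cong (λ row → lookup row j) (lookup∘updateAt′ i x i≢x G)
... | yes refl with j ≟ y
...   | no j≢y   = trans (cong (λ row → lookup row j) (lookup∘updateAt x G)) (lookup∘updateAt′ j y j≢y (lookup G x))
...   | yes refl = trans (cong (λ row → lookup row j) (lookup∘updateAt x G)) (lookup∘updateAt y (lookup G x))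

adj-toggle : ∀ x y (G : Graph W) i j →
  adj (toggle x y G) i j ≡ isPair x y i j xor (isPair y x i j xor adj G i j)
adj-toggle x y G i j = trans (adj-toggleArc x y (toggleArc y x G) i j)
  (cong (isPair x y i j xor_) (adj-toggleArc y x G i j))

lookup-ext : ∀ {n} {xs ys : Vec A n} → (∀ i → lookup xs i ≡ lookup ys i) → xs ≡ ys
lookup-ext {xs = []}     {[]}     h = refl
lookup-ext {xs = x ∷ xs} {y ∷ ys} h = cong₂ _∷_ (h zero) (lookup-ext (h ∘ suc))

adj-ext : {G H : Graph W} → (∀ i j → adj G i j ≡ adj H i j) → G ≡ H
adj-ext h = lookup-ext (λ i → lookup-ext (h i))

toggle-involutive : ∀ x y (G : Graph W) → toggle x y (toggle x y G) ≡ G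
toggle-involutive x y G = adj-ext λ i j → trans (adj-toggle x y (toggle x y G) i j)
  (trans (cong (λ b → isPair x y i j xor (isPair y x i j xor b)) (adj-toggle x y G i j))
    (lem (isPair x y i j) (isPair y x i j) (adj G i j)))
  where
  lem : ∀ a b c → a xor (b xor (a xor (b xor c))) ≡ c
  lem true  true  true  = refl
  lem true  true  false = refl
  lem true  false true  = refl
  lem true  false false = refl
  lem false true  true  = refl
  lem false true  false = refl
  lem false false _     = refl

isPair-swap : ∀ x y (i j : Fin W) → isPair x y i j ≡ isPair y x j i
isPair-swap x y i j = ∧-comm ⌊ i ≟ x ⌋ ⌊ j ≟ y ⌋

isPair-true : ∀ {x y i j : Fin W} → isPair x y i j ≡ true → (i ≡ x) × (j ≡ y)
isPair-true {x = x} {i = i} e = ⌊≟⌋⇒≡ (proj₁ (∧-split e)) , ⌊≟⌋⇒≡ (proj₂ (∧-split {⌊ i ≟ x ⌋} e))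

isPair-self : ∀ (x y : Fin W) → isPair x y x y ≡ true
isPair-self x y = ∧-intro (⌊≟⌋-refl x) (⌊≟⌋-refl y)

isPair-reversed : ∀ {x y : Fin W} → x ≢ y → isPair y x x y ≡ false
isPair-reversed x≢y rewrite ≢⇒⌊≟⌋ x≢y = refl

toggle-simple : ∀ x y {G : Graph W} → Simple G → Simple (toggle x y G)
toggle-simple x y {G} s = record
  { irreflexive = λ i → trans (adj-toggle x y G i i)
      (trans (cong (λ b → b xor (isPair y x i i xor adj G i i)) (isPair-swap x y i i))
        (trans (cancel (isPair y x i i) _) (irreflexive i)))
  ; symmetric   = λ i j → trans (adj-toggle x y G i j) (trans
      (trans (cong₂ (λ a b → a xor (b xor adj G i j)) (isPair-swap x y i j) (isPair-swap y x i j))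
        (trans (commute (isPair y x j i) (isPair x y j i) _)
          (cong (λ b → isPair x y j i xor (isPair y x j i xor b)) (symmetric i j))))
      (sym (adj-toggle x y G j i))) }
  where
  open Simple s
  cancel : ∀ a b → a xor (a xor b) ≡ b
  cancel true  true  = refl
  cancel true  false = refl
  cancel false _     = refl
  commute : ∀ a b c → a xor (b xor c) ≡ b xor (a xor c)
  commute true  true  _ = refl
  commute true  false _ = refl
  commute false true  _ = refl
  commute false false _ = refl

isSimple-toggle : ∀ x y (G : Graph W) → isSimple (toggle x y G) ≡ isSimple G
isSimple-toggle x y G = ⇔→≡
  (λ e → subst (λ H → isSimple H ≡ true) (toggle-involutive x y G)
    (Simple⇒isSimple (toggle-simple x y (isSimple⇒Simple (toggle x y G) e))))
  (λ e → Simple⇒isSimple (toggle-simple x y (isSimple⇒Simple G e)))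

adj⇒≢ : {G : Graph W} → Simple G → ∀ {x y} → adj G x y ≡ true → x ≢ y
adj⇒≢ s {x} e refl = true≢false e (Simple.irreflexive s x)

module _ {G : Graph W} (s : Simple G) {x y : Fin W} (xy : adj G x y ≡ true) where
  open Simple s

  private
    H : Graph W
    H = toggle x y G

    yx : adj G y x ≡ true
    yx = trans (symmetric y x) xy

    pair-adj : ∀ {a b i j} → isPair a b i j ≡ true → adj G i j ≡ adj G a b
    pair-adj p = let i≡a , j≡b = isPair-true p in cong₂ (adj G) i≡a j≡b

    arcs-differ : ∀ i j → isPair x y i j ≡ true → isPair y x i j ≡ true → ⊥
    arcs-differ i j p q = adj⇒≢ s xy
      (trans (sym (proj₁ (isPair-true {i = i} {j} p))) (proj₁ (isPair-true {i = i} {j} q)))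

  deleted-⊆ : ∀ i j → adj H i j ≡ true → adj G i j ≡ true
  deleted-⊆ i j e with isPair x y i j in p | isPair y x i j in q | adj-toggle x y G i j
  ... | true  | _     | _ = trans (pair-adj p) xy
  ... | false | true  | _ = trans (pair-adj q) yx
  ... | false | false | h = trans (sym h) e

  deleted-⊇ : ∀ i j → adj G i j ≡ true →
    (adj H i j ≡ true) ⊎ (((i ≡ x) × (j ≡ y)) ⊎ ((i ≡ y) × (j ≡ x)))
  deleted-⊇ i j e with isPair x y i j in p | isPair y x i j in q | adj-toggle x y G i j
  ... | true  | _     | _ = inj₂ (inj₁ (isPair-true p))
  ... | false | true  | _ = inj₂ (inj₂ (isPair-true q))
  ... | false | false | h = inj₁ (trans h e)

  deleted-edge : adj H x y ≡ false
  deleted-edge = trans (adj-toggle x y G x y)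
    (trans (cong₂ (λ a b → a xor (b xor adj G x y)) (isPair-self x y) (isPair-reversed (adj⇒≢ s xy))) (cong not xy))

  deleteEdge≡toggle : deleteEdge G x y ≡ H
  deleteEdge≡toggle = adj-ext λ i j → trans
    (trans (cong (λ row → lookup row j) (lookup∘tabulate _ i)) (lookup∘tabulate _ j))
    (trans (lem i j) (sym (adj-toggle x y G i j)))
    where
    removed : ∀ {b} → b ≡ true → b ∧ false ≡ not b
    removed refl = refl
    lem : ∀ i j → adj G i j ∧ not (isPair x y i j ∨ isPair y x i j) ≡ isPair x y i j xor (isPair y x i j xor adj G i j)
    lem i j with isPair x y i j in p | isPair y x i j in q
    ... | true  | true  = ⊥-elim (arcs-differ i j p q)
    ... | false | false = ∧-identityʳ _
    ... | true  | false = removed (trans (pair-adj {x} {y} {i} {j} p) xy)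
    ... | false | true  = removed (trans (pair-adj {y} {x} {i} {j} q) yx)

  path-split : ∀ {u v} → Path (adj G) u v →
    Path (adj H) u v ⊎ ((Path (adj H) u x × Path (adj H) y v) ⊎ (Path (adj H) u y × Path (adj H) x v))
  path-split [] = inj₁ []
  path-split (_▷_ {v} {w} p e) with path-split p | deleted-⊇ v w e
  ... | inj₁ q                | inj₁ f                    = inj₁ (q ▷ f)
  ... | inj₁ q                | inj₂ (inj₁ (refl , refl)) = inj₂ (inj₁ (q , []))
  ... | inj₁ q                | inj₂ (inj₂ (refl , refl)) = inj₂ (inj₂ (q , []))
  ... | inj₂ (inj₁ (q , q′))  | inj₁ f                    = inj₂ (inj₁ (q , q′ ▷ f))
  ... | inj₂ (inj₁ (q , q′))  | inj₂ (inj₁ (refl , refl)) = inj₂ (inj₁ (q , []))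
  ... | inj₂ (inj₁ (q , q′))  | inj₂ (inj₂ (refl , refl)) = inj₁ q
  ... | inj₂ (inj₂ (q , q′))  | inj₁ f                    = inj₂ (inj₂ (q , q′ ▷ f))
  ... | inj₂ (inj₂ (q , q′))  | inj₂ (inj₁ (refl , refl)) = inj₁ q
  ... | inj₂ (inj₂ (q , q′))  | inj₂ (inj₂ (refl , refl)) = inj₂ (inj₂ (q , []))

  merge : reachable H x y ≡ false → Merge (reachable H) (reachable G) x y
  merge sep = record
    { equiv = EH ; equiv′ = EG ; separate = sep ; joined = joined ; other = other }
    where
    EH = reachable-equiv (toggle-simple x y s)
    EG = reachable-equiv s
    grow : ∀ {u v} → reachable H u v ≡ true → reachable G u v ≡ true
    grow {u} e = reachable-complete G u (Path-mono deleted-⊆ (reachable-sound H u e))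
    G-xy : reachable G x y ≡ true
    G-xy = reachable-complete G x ([] ▷ xy)
    joined : ∀ v → reachable G x v ≡ reachable H x v ∨ reachable H y v
    joined v = ⇔→≡ to from
      where
      to : reachable G x v ≡ true → reachable H x v ∨ reachable H y v ≡ true
      to e with path-split (reachable-sound G x e)
      ... | inj₁ p              = cong (_∨ reachable H y v) (reachable-complete H x p)
      ... | inj₂ (inj₁ (_ , p)) = ∨-introʳ (reachable H x v) (reachable-complete H y p)
      ... | inj₂ (inj₂ (_ , p)) = cong (_∨ reachable H y v) (reachable-complete H x p)
      from : reachable H x v ∨ reachable H y v ≡ true → reachable G x v ≡ true
      from e with ∨-split {reachable H x v} e
      ... | inj₁ f = grow f
      ... | inj₂ f = trans (Equiv.tran EG G-xy v) (grow f)
    other : ∀ v → reachable G x v ≡ false → ∀ u → reachable G v u ≡ reachable H v u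
    other v sep′ u = ⇔→≡ to grow
      where
      to : reachable G v u ≡ true → reachable H v u ≡ true
      to e with path-split (reachable-sound G v e)
      ... | inj₁ p              = reachable-complete H v p
      ... | inj₂ (inj₁ (p , _)) = ⊥-elim (true≢false
              (trans (Equiv.symm EG x v) (grow (reachable-complete H v p))) sep′)
      ... | inj₂ (inj₂ (p , _)) = ⊥-elim (true≢false
              (trans (Equiv.tran EG G-xy v) (trans (Equiv.symm EG y v) (grow (reachable-complete H v p)))) sep′)

-- A Boolean, so that bridges can be counted, and stated by separation of the end points, which is
-- what the exchange needs. That the deletion then raises the number of components, as `IsBridge`
-- demands, follows from `classCount-merge`.
isBridge : Graph W → Fin W → Fin W → Bool
isBridge G x y = adj G x y ∧ not (reachable (toggle x y G) x y)

bridge-adj : (G : Graph W) {x y : Fin W} → isBridge G x y ≡ true → adj G x y ≡ true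
bridge-adj G b = proj₁ (∧-split b)

bridge-cuts : (G : Graph W) {x y : Fin W} → isBridge G x y ≡ true → reachable (toggle x y G) x y ≡ false
bridge-cuts G {x} {y} b = not-true (proj₂ (∧-split {adj G x y} b))

bridge-merge : {G : Graph W} → Simple G → ∀ {x y} → isBridge G x y ≡ true →
  Merge (reachable (toggle x y G)) (reachable G) x y
bridge-merge {G = G} s b = merge s (bridge-adj G b) (bridge-cuts G b)

-- Removing `xy` as well cannot reconnect `c` and `d`: G - xy - cd is a subgraph of G - cd.
bridge-persists : {G : Graph W} → Simple G → ∀ {x y c d} → adj G x y ≡ true → isBridge G c d ≡ true →
  ((c ≡ x) × (d ≡ y)) ⊎ (((c ≡ y) × (d ≡ x)) ⊎ (isBridge (toggle x y G) c d ≡ true))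
bridge-persists {G = G} s {x} {y} {c} {d} xy b with deleted-⊇ s xy c d (bridge-adj G b)
... | inj₂ (inj₁ e) = inj₁ e
... | inj₂ (inj₂ e) = inj₂ (inj₁ e)
... | inj₁ cd = inj₂ (inj₂ (∧-intro cd (cong not (¬true→false λ r → true≢false
        (reachable-complete (toggle c d G) c (Path-mono incl (reachable-sound H′ c r))) (bridge-cuts G b)))))
  where
  H  = toggle x y G
  H′ = toggle c d H
  sH  = toggle-simple x y s
  sH′ = toggle-simple c d sH
  incl : ∀ i j → adj H′ i j ≡ true → adj (toggle c d G) i j ≡ true
  incl i j e with deleted-⊇ s (bridge-adj G b) i j (deleted-⊆ s xy i j (deleted-⊆ sH cd i j e))
  ... | inj₁ f = f
  ... | inj₂ (inj₁ (refl , refl)) = ⊥-elim (true≢false e (deleted-edge sH cd))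
  ... | inj₂ (inj₂ (refl , refl)) = ⊥-elim (true≢false (trans (Simple.symmetric sH′ c d) e) (deleted-edge sH cd))

-- Invariance of sums over all matrices

allGraphs : (W : ℕ) → List (Graph W)
allGraphs W = allVecs (allVecs (true ∷ false ∷ []) W) W

-- Invariance of all sums under `h` stands in for the statement that `h` permutes `xs`, and it
-- passes from entries to vectors. `∑-toggle` uses it on two levels: for the entries of a row and
-- for the rows of the matrix.
∑-allVecs-updateAt : (xs : List A) (h : A → A) → (∀ f → ∑ xs (f ∘ h) ≡ ∑ xs f) →
  ∀ {n} (i : Fin n) f → ∑[ v ∈ allVecs xs n ] f (updateAt v i h) ≡ ∑ (allVecs xs n) f
∑-allVecs-updateAt xs h inv {suc n} i f = trans (∑-concatMap _ xs _) (trans (split i) (sym (∑-concatMap _ xs f)))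
  where
  tails = allVecs xs n
  split : ∀ i → ∑[ x ∈ xs ] ∑[ v ∈ map (x ∷_) tails ] f (updateAt v i h) ≡ ∑[ x ∈ xs ] ∑ (map (x ∷_) tails) f
  split zero = trans (∑-cong xs (λ x → trans (∑-map (x ∷_) tails _) (sym (∑-map (h x ∷_) tails f))))
    (inv (λ x → ∑ (map (x ∷_) tails) f))
  split (suc i) = ∑-cong xs (λ x → trans (∑-map (x ∷_) tails _)
    (trans (∑-allVecs-updateAt xs h inv i (f ∘ (x ∷_))) (sym (∑-map (x ∷_) tails f))))

∑-toggle : ∀ x y (f : Graph W → ℕ) → ∑[ G ∈ allGraphs W ] f (toggle x y G) ≡ ∑ (allGraphs W) f
∑-toggle {W} x y f = trans (arc y x (λ G → f (toggleArc x y G))) (arc x y f)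
  where
  swap : (f : Bool → ℕ) → ∑ (true ∷ false ∷ []) (f ∘ not) ≡ ∑ (true ∷ false ∷ []) f
  swap f = lem (f false) (f true)
    where
    lem : ∀ a b → a + (b + 0) ≡ b + (a + 0)
    lem = solve-∀
  arc : ∀ x y (f : Graph W → ℕ) → ∑[ G ∈ allGraphs W ] f (toggleArc x y G) ≡ ∑ (allGraphs W) f
  arc x y = ∑-allVecs-updateAt _ _ (∑-allVecs-updateAt _ not swap y) x

-- Bridges inside a component

bridgeDegree : Graph W → Fin W → ℕ
bridgeDegree G c = ∑ⱽ[ d ] 𝟙 (isBridge G c d)

∑-isPair : ∀ (x y : Fin W) → ∑ⱽ[ c ] ∑ⱽ[ d ] 𝟙 (isPair x y c d) ≡ 1
∑-isPair {W} x y = trans (∑ⱽ-single _ x outer) (trans (∑ⱽ-single _ y inner) (cong 𝟙 (isPair-self x y)))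
  where
  inner : ∀ d → d ≢ y → 𝟙 (isPair x y x d) ≡ 0
  inner d d≢y = cong 𝟙 (¬true→false λ e → d≢y (proj₂ (isPair-true {x = x} {y} {x} {d} e)))
  outer : ∀ c → c ≢ x → ∑ⱽ[ d ] 𝟙 (isPair x y c d) ≡ 0
  outer c c≢x = trans (∑-cong (allFin W) λ d → cong 𝟙 (¬true→false λ e → c≢x (proj₁ (isPair-true {x = x} {y} {c} {d} e))))
    (∑-zero (allFin W))

-- Deleting a bridge destroys no other bridge; the 2 counts its two orientations.
bridgeDegree-delete : {G : Graph W} → Simple G → ∀ {a b} → adj G a b ≡ true → (s : Fin W → Bool) →
  ∑ⱽ[ c ] (𝟙 (s c) * bridgeDegree G c) ≤ 2 + ∑ⱽ[ c ] (𝟙 (s c) * bridgeDegree (toggle a b G) c)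
bridgeDegree-delete {W} {G} simple {a} {b} ab s = begin
  ∑ⱽ[ c ] (𝟙 (s c) * bridgeDegree G c)
    ≤⟨ ∑-mono V (λ c → ≤-trans (*-monoʳ-≤ (𝟙 (s c)) (degree c)) (drop (s c) _ _)) ⟩
  ∑ⱽ[ c ] (pairs c + 𝟙 (s c) * bridgeDegree H c)
    ≡⟨ ∑-+ V _ _ ⟩
  (∑ⱽ[ c ] pairs c) + ∑ⱽ[ c ] (𝟙 (s c) * bridgeDegree H c)
    ≡⟨ cong (_+ (∑ⱽ[ c ] (𝟙 (s c) * bridgeDegree H c))) (trans (∑-cong V λ c → ∑-+ V _ _)
         (trans (∑-+ V _ _) (cong₂ _+_ (∑-isPair a b) (∑-isPair b a)))) ⟩
  2 + ∑ⱽ[ c ] (𝟙 (s c) * bridgeDegree H c) ∎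
  where
  open ≤-Reasoning
  V = allFin W
  H = toggle a b G
  pairs : Fin W → ℕ
  pairs c = ∑ⱽ[ d ] (𝟙 (isPair a b c d) + 𝟙 (isPair b a c d))
  arc : ∀ c d → 𝟙 (isBridge G c d) ≤ (𝟙 (isPair a b c d) + 𝟙 (isPair b a c d)) + 𝟙 (isBridge H c d)
  arc c d with isBridge G c d in e
  ... | false = z≤n
  ... | true with bridge-persists simple ab e
  ...   | inj₁ (refl , refl)        rewrite isPair-self c d = s≤s z≤n
  ...   | inj₂ (inj₁ (refl , refl)) rewrite isPair-self c d = ≤-trans (m≤n+m 1 (𝟙 (isPair d c c d))) (m≤m+n _ _)
  ...   | inj₂ (inj₂ e′)            rewrite e′ = m≤n+m 1 _
  degree : ∀ c → bridgeDegree G c ≤ pairs c + bridgeDegree H c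
  degree c = ≤-trans (∑-mono V (arc c)) (≤-reflexive (∑-+ V _ _))
  drop : ∀ e m n → 𝟙 e * (m + n) ≤ m + 𝟙 e * n
  drop true  m n = ≤-reflexive (lem m n)
    where
    lem : ∀ m n → 1 * (m + n) ≡ m + 1 * n
    lem = solve-∀
  drop false m n = z≤n

componentSize : Graph W → Fin W → ℕ
componentSize G = classSize (reachable G)

bridgesIn : Graph W → Fin W → ℕ
bridgesIn G a = ∑ⱽ[ c ] (𝟙 (reachable G a c) * bridgeDegree G c)

-- The bridges of a component form a forest; with both orientations counted this is 2m + 2 ≤ 2w.
-- Induction on a bound for the size: deleting a bridge `cd` splits the component into two smaller
-- ones that keep all other bridges. The two orientations of `cd` and the 2 in the claim supply the
-- 2 needed for each piece.
bridgesIn-bound′ : ∀ n (G : Graph W) → Simple G → ∀ a → componentSize G a ≤ n →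
  bridgesIn G a + 2 ≤ 2 * componentSize G a
bridgesIn-bound′ zero G s a a≤0 = ⊥-elim (1+n≰n (≤-trans (classSize≥1 (reachable-equiv s) a) a≤0))
bridgesIn-bound′ {W} (suc n) G s a a≤n with anyᶠ (λ c → reachable G a c ∧ anyᶠ (isBridge G c)) in eq
... | false = ≤-trans (≤-reflexive (cong (_+ 2) none)) (*-monoʳ-≤ 2 (classSize≥1 (reachable-equiv s) a))
  where
  noBridge : ∀ c d → reachable G a c ≡ true → 𝟙 (isBridge G c d) ≡ 0
  noBridge c d e = cong 𝟙 (¬true→false λ b → true≢false
    (anyᶠ⁺ (λ c → reachable G a c ∧ anyᶠ (isBridge G c)) c (∧-intro e (anyᶠ⁺ (isBridge G c) d b))) eq)
  none : bridgesIn G a ≡ 0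
  none = trans (∑-cong (allFin W) λ c → trans
      (guard (reachable G a c) (λ e → trans (∑-cong (allFin W) λ d → noBridge c d e) (∑-zero (allFin W))))
      (*-zeroʳ (𝟙 (reachable G a c))))
    (∑-zero (allFin W))
... | true with anyᶠ⁻ (λ c → reachable G a c ∧ anyᶠ (isBridge G c)) eq
...   | c , h with ∧-split {reachable G a c} h
...     | ac , h′ with anyᶠ⁻ (isBridge G c) h′
...       | d , b = begin
  bridgesIn G a + 2                                  ≡⟨ cong (_+ 2) (∑-cong V λ e → cong (λ t → 𝟙 t * bridgeDegree G e) (tran ac e)) ⟩
  bridgesIn G c + 2                                  ≤⟨ +-monoˡ-≤ 2 (bridgeDegree-delete s (bridge-adj G b) (reachable G c)) ⟩
  2 + (∑ⱽ[ e ] (𝟙 (reachable G c e) * bridgeDegree H e)) + 2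
    ≡⟨ cong (λ z → 2 + z + 2) (trans (∑-cong V λ e → trans (cong (_* bridgeDegree H e) (𝟙-joined e))
         (*-distribʳ-+ (bridgeDegree H e) (𝟙 (reachable H c e)) _)) (∑-+ V _ _)) ⟩
  2 + (bridgesIn H c + bridgesIn H d) + 2            ≡⟨ lem₁ (bridgesIn H c) (bridgesIn H d) ⟩
  (bridgesIn H c + 2) + (bridgesIn H d + 2)
    ≤⟨ +-mono-≤ (bridgesIn-bound′ n H sH c (<⇒≤pred (≤-trans (m<m+n _ (classSize≥1 equiv d)) total)))
                (bridgesIn-bound′ n H sH d (<⇒≤pred (≤-trans (m<n+m _ (classSize≥1 equiv c)) total))) ⟩
  2 * componentSize H c + 2 * componentSize H d      ≡⟨ *-distribˡ-+ 2 (componentSize H c) _ ⟨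
  2 * (componentSize H c + componentSize H d)        ≡⟨ cong (2 *_) classSize-joined ⟨
  2 * componentSize G c                              ≡⟨ cong (2 *_) (classSize-cong equiv′ ac) ⟨
  2 * componentSize G a                              ∎
  where
  open ≤-Reasoning
  V = allFin W
  H = toggle c d G
  sH = toggle-simple c d s
  open Merge (bridge-merge s b)
  open Equiv equiv′ using (tran)
  total : componentSize H c + componentSize H d ≤ suc n
  total = ≤-trans (≤-reflexive (trans (sym classSize-joined) (sym (classSize-cong equiv′ ac)))) a≤n
  lem₁ : ∀ a b → 2 + (a + b) + 2 ≡ (a + 2) + (b + 2)
  lem₁ = solve-∀

bridgesIn-bound : {G : Graph W} → Simple G → ∀ a → bridgesIn G a + 2 ≤ 2 * componentSize G a
bridgesIn-bound {G = G} s a = bridgesIn-bound′ _ G s a ≤-refl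

-- Exchange: graphs with a marked bridge versus graphs with a marked pair of separated vertices

components≡classCount : (G : Graph W) → components G ≡ classCount (reachable G)
components≡classCount {W} G = length-filterᵇ _ (allFin W)

module Exchange {W} (𝒜 : Class W) (alterable : BridgeAlterable 𝒜) where

  inLevel : ℕ → Graph W → Bool
  inLevel j G = isSimple G ∧ (𝒜 G ∧ (components G ≡ᵇ j))

  -- An indicator over all matrices instead of a sum over a filtered list, so that `∑-toggle`
  -- applies directly.
  ∑ᴸ : ℕ → (Graph W → ℕ) → ℕ
  ∑ᴸ j Ψ = ∑[ G ∈ allGraphs W ] (𝟙 (inLevel j G) * Ψ G)

  inLevel⇒Simple : ∀ {j G} → inLevel j G ≡ true → Simple G
  inLevel⇒Simple {j} {G} e = isSimple⇒Simple G (proj₁ (∧-split e))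

  inLevel⇒classCount : ∀ {j G} → inLevel j G ≡ true → classCount (reachable G) ≡ j
  inLevel⇒classCount {j} {G} e = trans (sym (components≡classCount G))
    (≡ᵇ⇒≡ _ _ (≡true⇒T (proj₂ (∧-split {𝒜 G} (proj₂ (∧-split {isSimple G} e))))))

  -- The correspondence of (G, xy) with (H, xy) for fixed `x` and `y`, read on indicators. If `x`
  -- and `y` are connected in H, both sides vanish. Otherwise the flip inserts `xy` and joins two
  -- components, so `xy` is a bridge of the new graph, and alterability makes the two graphs members
  -- of `𝒜` together.
  inLevel-toggle : ∀ j x y H →
    inLevel j (toggle x y H) ∧ isBridge (toggle x y H) x y ≡ inLevel (suc j) H ∧ not (reachable H x y)
  inLevel-toggle j x y H rewrite toggle-involutive x y H | isSimple-toggle x y H with isSimple H in sH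
  ... | false = refl
  ... | true with reachable H x y in xy
  ...   | true  = absorb (𝒜 (toggle x y H) ∧ (components (toggle x y H) ≡ᵇ j)) (adj (toggle x y H) x y) _
    where
    absorb : ∀ a b c → a ∧ (b ∧ false) ≡ c ∧ false
    absorb a b c = trans (cong (a ∧_) (∧-zeroʳ b)) (trans (∧-zeroʳ a) (sym (∧-zeroʳ c)))
  ...   | false = trans (∧-skip xyG) (cong (_∧ true) (cong₂ _∧_ sameClass sameLevel))
    where
    G = toggle x y H
    simpleH = isSimple⇒Simple H sH
    simpleG = toggle-simple x y simpleH
    x≢y : x ≢ y
    x≢y refl = true≢false (reachable-complete H x []) xy
    xyH : adj H x y ≡ false
    xyH = ¬true→false λ e → true≢false (reachable-complete H x ([] ▷ e)) xy
    xyG : adj G x y ≡ true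
    xyG = trans (adj-toggle x y H x y)
      (cong₂ (λ a b → a xor b) (isPair-self x y) (cong₂ _xor_ (isPair-reversed x≢y) xyH))
    ∧-skip : ∀ {a b} → b ≡ true → a ∧ (b ∧ true) ≡ a ∧ true
    ∧-skip refl = refl
    mergeGH : Merge (reachable H) (reachable G) x y
    mergeGH = subst (λ K → Merge (reachable K) (reachable G) x y) (toggle-involutive x y H)
      (merge simpleG xyG (trans (cong (λ K → reachable K x y) (toggle-involutive x y H)) xy))
    count : components H ≡ suc (components G)
    count = trans (components≡classCount H) (trans (Merge.classCount-merge mergeGH) (cong suc (sym (components≡classCount G))))
    deleted : deleteEdge G x y ≡ H
    deleted = trans (deleteEdge≡toggle simpleG xyG) (toggle-involutive x y H)
    sameClass : 𝒜 G ≡ 𝒜 H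
    sameClass = trans (alterable G (Simple⇒isSimple simpleG) x y
      (xyG , ≤-reflexive (trans (sym count) (cong components (sym deleted))))) (cong 𝒜 deleted)
    sameLevel : (components G ≡ᵇ j) ≡ (components H ≡ᵇ suc j)
    sameLevel rewrite count = refl

  -- For each `x` and `y`, substitute `toggle x y` in the sum over graphs and apply
  -- `inLevel-toggle`. `Φ` is the quantity `Ψ` expressed through the graph without the bridge.
  exchange : ∀ j (Ψ Φ : Graph W → Fin W → Fin W → ℕ) →
    (∀ G x y → Simple G → isBridge G x y ≡ true → Ψ G x y ≡ Φ (toggle x y G) x y) →
    ∑ᴸ j (λ G → ∑ⱽ[ x ] ∑ⱽ[ y ] (𝟙 (isBridge G x y) * Ψ G x y)) ≡
    ∑ᴸ (suc j) (λ H → ∑ⱽ[ x ] ∑ⱽ[ y ] (𝟙 (not (reachable H x y)) * Φ H x y))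
  exchange j Ψ Φ h = trans (pull (inLevel j) isBridge Ψ) (trans (∑-cong V λ x → ∑-cong V λ y → step x y)
    (sym (pull (inLevel (suc j)) (λ H x y → not (reachable H x y)) Φ)))
    where
    V = allFin W
    pull : (l : Graph W → Bool) (b : Graph W → Fin W → Fin W → Bool) (Θ : Graph W → Fin W → Fin W → ℕ) →
      ∑[ G ∈ allGraphs W ] (𝟙 (l G) * ∑ⱽ[ x ] ∑ⱽ[ y ] (𝟙 (b G x y) * Θ G x y)) ≡
      ∑ⱽ[ x ] ∑ⱽ[ y ] ∑[ G ∈ allGraphs W ] (𝟙 (l G ∧ b G x y) * Θ G x y)
    pull l b Θ = trans (∑-cong (allGraphs W) (λ G → trans (sym (∑-*ˡ V (𝟙 (l G)) _))
        (∑-cong V λ x → trans (sym (∑-*ˡ V (𝟙 (l G)) _)) (∑-cong V λ y →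
          trans (sym (*-assoc (𝟙 (l G)) _ _)) (cong (_* Θ G x y) (sym (𝟙-∧ (l G) (b G x y))))))))
      (trans (∑-swap (allGraphs W) V _) (∑-cong V λ x → ∑-swap (allGraphs W) V _))
    step : ∀ x y → ∑[ G ∈ allGraphs W ] (𝟙 (inLevel j G ∧ isBridge G x y) * Ψ G x y) ≡
      ∑[ H ∈ allGraphs W ] (𝟙 (inLevel (suc j) H ∧ not (reachable H x y)) * Φ H x y)
    step x y = trans (∑-cong (allGraphs W) λ G → guard (inLevel j G ∧ isBridge G x y)
        (λ e → let l , b = ∧-split {inLevel j G} e in h G x y (inLevel⇒Simple {j} {G} l) b))
      (trans (sym (∑-toggle x y _)) (∑-cong (allGraphs W) λ H →
        cong₂ (λ t K → 𝟙 t * Φ K x y) (inLevel-toggle j x y H) (toggle-involutive x y H)))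

-- Weighted counts in one graph: each of the s vertices of a class of size s receives the share g s of D

module Weighted {W} {r : Fin W → Fin W → Bool} (E : Equiv r) (deg : Fin W → ℕ)
  (g : ℕ → ℕ) (D : ℕ) (g-share : ∀ s → 1 ≤ s → s ≤ W → g s * s ≡ D) where
  open Equiv E

  private
    V : List (Fin W)
    V = allFin W

    w : Fin W → ℕ
    w = classSize r

    L : Fin W → ℕ
    L u = 𝟙 (isLeast r u)

    apart : Fin W → Fin W → ℕ
    apart a b = 𝟙 (not (r a b))

  degIn : Fin W → ℕ
  degIn a = ∑ⱽ[ c ] (𝟙 (r a c) * deg c)

  degIn-cong : ∀ {a b} → r a b ≡ true → degIn a ≡ degIn b
  degIn-cong e = ∑-cong V (λ c → cong (λ t → 𝟙 t * deg c) (tran e c))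

  apart-sym : ∀ a b → apart a b ≡ apart b a
  apart-sym a b = cong (𝟙 ∘ not) (symm a b)

  apart-congˡ : ∀ {a b} → r a b ≡ true → ∀ c → apart a c ≡ apart b c
  apart-congˡ e c = cong (𝟙 ∘ not) (tran e c)

  apart-congʳ : ∀ {a b} → r a b ≡ true → ∀ c → apart c a ≡ apart c b
  apart-congʳ e c = cong (𝟙 ∘ not) (tranʳ e c)

  apart-size : ∀ {a b} → not (r a b) ≡ true → w a + w b ≤ W
  apart-size {a} {b} e = begin
    w a + w b                            ≡⟨ ∑-+ V _ _ ⟨
    ∑ⱽ[ v ] (𝟙 (r a v) + 𝟙 (r b v))      ≤⟨ ∑-mono V one ⟩
    ∑ⱽ {W} (λ _ → 1)                     ≡⟨ trans (∑ⱽ-const {W} 1) (*-identityʳ W) ⟩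
    W                                    ∎
    where
    open ≤-Reasoning
    one : ∀ v → 𝟙 (r a v) + 𝟙 (r b v) ≤ 1
    one v with r a v in p | r b v in q
    ... | true  | true  = ⊥-elim (true≢false (trans (tran p b) (trans (symm v b) q)) (not-true e))
    ... | true  | false = ≤-refl
    ... | false | true  = ≤-refl
    ... | false | false = z≤n

  share-apart : ∀ a b → apart a b * D ≡ apart a b * (g (w a + w b) * (w a + w b))
  share-apart a b = guard (not (r a b)) λ e →
    sym (g-share (w a + w b) (≤-trans (classSize≥1 E a) (m≤m+n _ _)) (apart-size e))

  ∑∑-classes : (f : Fin W → Fin W → ℕ) →
    (∀ {a b} c → r a b ≡ true → f a c ≡ f b c) → (∀ {a b} c → r a b ≡ true → f c a ≡ f c b) →
    ∑ⱽ[ x ] ∑ⱽ[ y ] f x y ≡ ∑ⱽ[ a ] ∑ⱽ[ b ] (L a * L b * (w a * w b * f a b))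
  ∑∑-classes f f₁ f₂ = trans (∑-cong V (λ x → ∑-classes E (f x) (f₂ x)))
    (trans (∑-classes E _ (λ e → ∑-cong V (λ b → cong (λ z → L b * (w b * z)) (f₁ b e))))
      (∑-cong V λ a → trans (cong (L a *_) (sym (∑-*ˡ V (w a) _))) (trans (sym (∑-*ˡ V (L a) _))
        (∑-cong V λ b → lem (L a) (w a) (L b) (w b) (f a b)))))
    where
    lem : ∀ la wa lb wb f → la * (wa * (lb * (wb * f))) ≡ la * lb * (wa * wb * f)
    lem = solve-∀

  -- The weight of the component that an edge between `a` and `b` would create, and 0 if they
  -- already lie in one class.
  θ : Fin W → Fin W → ℕ
  θ a b = apart a b * g (w a + w b)

  θ-cong₁ : ∀ {a b} c → r a b ≡ true → θ a c ≡ θ b c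
  θ-cong₁ c e = cong₂ (λ s t → s * g (t + w c)) (apart-congˡ e c) (classSize-cong E e)

  θ-cong₂ : ∀ {a b} c → r a b ≡ true → θ c a ≡ θ c b
  θ-cong₂ c e = cong₂ (λ s t → s * g (w c + t)) (apart-congʳ e c) (classSize-cong E e)

  θ-sym : ∀ a b → θ a b ≡ θ b a
  θ-sym a b = cong₂ (λ s t → s * g t) (apart-sym a b) (+-comm (w a) (w b))

  private
    -- Sum over the ordered pairs of classes, each represented by its least vertex.
    Σᶜ : (Fin W → Fin W → ℕ) → ℕ
    Σᶜ X = ∑ⱽ[ a ] ∑ⱽ[ b ] (L a * L b * X a b)

    Σᶜ-+ : ∀ X Y → Σᶜ (λ a b → X a b + Y a b) ≡ Σᶜ X + Σᶜ Y
    Σᶜ-+ X Y = trans (∑-cong V λ a → trans (∑-cong V λ b → *-distribˡ-+ (L a * L b) (X a b) (Y a b)) (∑-+ V _ _)) (∑-+ V _ _)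

    Σᶜ-mono : ∀ {X Y} → (∀ a b → X a b ≤ Y a b) → Σᶜ X ≤ Σᶜ Y
    Σᶜ-mono h = ∑-mono V λ a → ∑-mono V λ b → *-monoʳ-≤ (L a * L b) (h a b)

    Σᶜ-*ˡ : ∀ c X → Σᶜ (λ a b → c * X a b) ≡ c * Σᶜ X
    Σᶜ-*ˡ c X = trans (∑-cong V λ a → trans (∑-cong V λ b → lem (L a) (L b) c (X a b)) (∑-*ˡ V c _)) (∑-*ˡ V c _)
      where
      lem : ∀ l m c x → l * m * (c * x) ≡ c * (l * m * x)
      lem = solve-∀

  module _ {k} (count : classCount r ≡ suc k) where
    private
      -- For separate classes `θ a b * (w a + w b)` is `D`. What remains is the sum of `w b`, which
      -- is `W`, times the `k` classes other than that of `b`.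
      total : k * W * D ≡ Σᶜ (λ a b → w b * (θ a b * (w a + w b)))
      total = sym (begin
        Σᶜ (λ a b → w b * (θ a b * (w a + w b)))
          ≡⟨ ∑-swap V V _ ⟩
        ∑ⱽ[ b ] ∑ⱽ[ a ] (L a * L b * (w b * (θ a b * (w a + w b))))
          ≡⟨ ∑-cong V (λ b → trans (∑-cong V (λ a → point a b)) (∑-*ˡ V (L b * w b * D) _)) ⟩
        ∑ⱽ[ b ] (L b * w b * D * ∑ⱽ[ a ] (L a * apart b a))
          ≡⟨ ∑-cong V (λ b → cong (L b * w b * D *_) (suc-injective (trans (sym (∑-otherLeast E b)) count))) ⟩
        ∑ⱽ[ b ] (L b * w b * D * k)
          ≡⟨ trans (∑-*ʳ V k _) (cong (_* k) (trans (∑-*ʳ V D _) (cong (_* D) (∑-classSize E)))) ⟩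
        W * D * k
          ≡⟨ lem W D k ⟩
        k * W * D ∎)
        where
        open ≡-Reasoning
        lem : ∀ a b c → a * b * c ≡ c * a * b
        lem = solve-∀
        lem₁ : ∀ la lb wb s t → la * lb * (wb * (s * t)) ≡ la * lb * wb * (s * t)
        lem₁ = solve-∀
        lem₂ : ∀ la lb wb s d → la * lb * wb * (s * d) ≡ lb * wb * d * (la * s)
        lem₂ = solve-∀
        point : ∀ a b → L a * L b * (w b * (θ a b * (w a + w b))) ≡ L b * w b * D * (L a * apart b a)
        point a b = begin
          L a * L b * (w b * (θ a b * (w a + w b)))
            ≡⟨ cong (λ z → L a * L b * (w b * z)) (*-assoc (apart a b) (g (w a + w b)) (w a + w b)) ⟩
          L a * L b * (w b * (apart a b * (g (w a + w b) * (w a + w b))))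
            ≡⟨ cong (λ z → L a * L b * (w b * z)) (share-apart a b) ⟨
          L a * L b * (w b * (apart a b * D))
            ≡⟨ trans (lem₁ (L a) (L b) (w b) (apart a b) D) (lem₂ (L a) (L b) (w b) (apart a b) D) ⟩
          L b * w b * D * (L a * apart a b)
            ≡⟨ cong (λ z → L b * w b * D * (L a * z)) (apart-sym a b) ⟩
          L b * w b * D * (L a * apart b a) ∎

      marked : ∑ⱽ[ p ] (deg p * ∑ⱽ[ v ] (apart p v * (g (w p + w v) * w v))) ≡
        Σᶜ (λ a b → degIn a * (w b * (θ a b * w b)))
      marked = trans (∑-by-class E deg _ (λ e → ∑-cong V λ v →
          cong₂ (λ s t → s * (g (t + w v) * w v)) (apart-congˡ e v) (classSize-cong E e)))
        (∑-cong V λ a → trans (cong (λ z → L a * (degIn a * z)) (∑-classes E _ (λ e →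
            cong₂ (λ s t → s * (g (w a + t) * t)) (apart-congʳ e a) (classSize-cong E e))))
          (trans (cong (L a *_) (sym (∑-*ˡ V (degIn a) _))) (trans (sym (∑-*ˡ V (L a) _))
            (∑-cong V λ b → lem (L a) (degIn a) (L b) (w b) (apart a b) (g (w a + w b))))))
        where
        lem : ∀ la m lb wb s t → la * (m * (lb * (wb * (s * (t * wb))))) ≡ la * lb * (m * (wb * (s * t * wb)))
        lem = solve-∀

      pairs : ∑ⱽ[ x ] ∑ⱽ[ y ] θ x y ≡ Σᶜ (λ a b → w a * w b * θ a b)
      pairs = ∑∑-classes θ θ-cong₁ θ-cong₂

      -- By symmetry the share of D carried by x equals the one carried by y.
      pairsD : ∑ⱽ[ x ] ∑ⱽ[ y ] (apart x y * D) ≡ 2 * Σᶜ (λ a b → w a * w b * (θ a b * w b))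
      pairsD = begin
        ∑ⱽ[ x ] ∑ⱽ[ y ] (apart x y * D)
          ≡⟨ ∑-cong V (λ x → trans (∑-cong V (λ y → point x y)) (∑-+ V _ _)) ⟩
        ∑ⱽ[ x ] (∑ⱽ[ y ] (θ x y * w x) + ∑ⱽ[ y ] (θ x y * w y))
          ≡⟨ ∑-+ V _ _ ⟩
        ∑ⱽ[ x ] ∑ⱽ[ y ] (θ x y * w x) + ∑ⱽ[ x ] ∑ⱽ[ y ] (θ x y * w y)
          ≡⟨ cong (_+ (∑ⱽ[ x ] ∑ⱽ[ y ] (θ x y * w y))) (trans (∑-swap V V _)
               (∑-cong V λ y → ∑-cong V λ x → cong (_* w x) (θ-sym x y))) ⟩
        ∑ⱽ[ x ] ∑ⱽ[ y ] (θ x y * w y) + ∑ⱽ[ x ] ∑ⱽ[ y ] (θ x y * w y)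
          ≡⟨ double (∑ⱽ[ x ] ∑ⱽ[ y ] (θ x y * w y)) ⟩
        2 * ∑ⱽ[ x ] ∑ⱽ[ y ] (θ x y * w y)
          ≡⟨ cong (2 *_) (∑∑-classes _ (λ c e → cong (_* w c) (θ-cong₁ c e))
               (λ c e → cong₂ _*_ (θ-cong₂ c e) (classSize-cong E e))) ⟩
        2 * Σᶜ (λ a b → w a * w b * (θ a b * w b)) ∎
        where
        open ≡-Reasoning
        double : ∀ n → n + n ≡ 2 * n
        double = solve-∀
        point : ∀ x y → apart x y * D ≡ θ x y * w x + θ x y * w y
        point x y = trans (share-apart x y) (trans (sym (*-assoc (apart x y) _ _)) (*-distribˡ-+ (θ x y) (w x) (w y)))

    -- For one ordered pair of classes of sizes a and b, with m = `degIn a` and the common factor θ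
    -- removed, the claim is 2b(a + b) + mb² ≤ 2ab + 2ab². Subtracting 2ab leaves (m + 2)b² ≤ 2ab²,
    -- which is the bound on the bridges in the class. This is the place where 1 is replaced by |A|
    -- - (bridges in A).
    separated-bound : (∀ a → degIn a + 2 ≤ 2 * w a) →
      2 * (k * W * D) + ∑ⱽ[ p ] (deg p * ∑ⱽ[ v ] (apart p v * (g (w p + w v) * w v))) ≤
      ∑ⱽ[ x ] ∑ⱽ[ y ] (apart x y * (2 * g (w x + w y) + D))
    separated-bound bound = begin
      2 * (k * W * D) + ∑ⱽ[ p ] (deg p * ∑ⱽ[ v ] (apart p v * (g (w p + w v) * w v)))
        ≡⟨ cong₂ _+_ (trans (cong (2 *_) total) (sym (Σᶜ-*ˡ 2 _))) marked ⟩
      Σᶜ (λ a b → 2 * (w b * (θ a b * (w a + w b)))) + Σᶜ (λ a b → degIn a * (w b * (θ a b * w b)))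
        ≡⟨ Σᶜ-+ _ _ ⟨
      Σᶜ (λ a b → 2 * (w b * (θ a b * (w a + w b))) + degIn a * (w b * (θ a b * w b)))
        ≤⟨ Σᶜ-mono (λ a b → point (w a) (w b) (θ a b) (degIn a) (bound a)) ⟩
      Σᶜ (λ a b → 2 * (w a * w b * θ a b) + 2 * (w a * w b * (θ a b * w b)))
        ≡⟨ trans (Σᶜ-+ _ _) (cong₂ _+_ (Σᶜ-*ˡ 2 _) (Σᶜ-*ˡ 2 _)) ⟩
      2 * Σᶜ (λ a b → w a * w b * θ a b) + 2 * Σᶜ (λ a b → w a * w b * (θ a b * w b))
        ≡⟨ cong₂ _+_ (cong (2 *_) pairs) pairsD ⟨
      2 * ∑ⱽ[ x ] ∑ⱽ[ y ] θ x y + ∑ⱽ[ x ] ∑ⱽ[ y ] (apart x y * D)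
        ≡⟨ cong (_+ (∑ⱽ[ x ] ∑ⱽ[ y ] (apart x y * D))) (trans (sym (∑-*ˡ V 2 _)) (∑-cong V λ x → sym (∑-*ˡ V 2 _))) ⟩
      ∑ⱽ[ x ] ∑ⱽ[ y ] (2 * θ x y) + ∑ⱽ[ x ] ∑ⱽ[ y ] (apart x y * D)
        ≡⟨ trans (∑-cong V λ x → ∑-+ V _ _) (∑-+ V _ _) ⟨
      ∑ⱽ[ x ] ∑ⱽ[ y ] (2 * θ x y + apart x y * D)
        ≡⟨ ∑-cong V (λ x → ∑-cong V λ y → lem (apart x y) (g (w x + w y)) D) ⟩
      ∑ⱽ[ x ] ∑ⱽ[ y ] (apart x y * (2 * g (w x + w y) + D)) ∎
      where
      open ≤-Reasoning
      lem : ∀ s t d → 2 * (s * t) + s * d ≡ s * (2 * t + d)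
      lem = solve-∀
      lem₁ : ∀ a b t m → 2 * (b * (t * (a + b))) + m * (b * (t * b)) ≡ 2 * (a * b * t) + (m + 2) * (b * (t * b))
      lem₁ = solve-∀
      lem₂ : ∀ a b t → 2 * (a * b * t) + 2 * a * (b * (t * b)) ≡ 2 * (a * b * t) + 2 * (a * b * (t * b))
      lem₂ = solve-∀
      point : ∀ a b t m → m + 2 ≤ 2 * a →
        2 * (b * (t * (a + b))) + m * (b * (t * b)) ≤ 2 * (a * b * t) + 2 * (a * b * (t * b))
      point a b t m h = ≤-trans (≤-reflexive (lem₁ a b t m)) (≤-trans
        (+-monoʳ-≤ (2 * (a * b * t)) (*-monoˡ-≤ (b * (t * b)) h)) (≤-reflexive (lem₂ a b t)))

  -- For one class with D = gw and m = `degIn`, division by g leaves 10m + 4mw ≤ 4w² + 20w + m²,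
  -- that is (2w - m)² + 10(2w - m) ≥ 0. The 10 is 4 · 2 from the summand `2 * g` plus 2 from the
  -- second sum; it produces 20w, the origin of the 5 in `W + 5 * k`.
  bridge-bound : ∀ {k} → classCount r ≡ k → (∀ a → degIn a + 2 ≤ 2 * w a) →
    4 * ∑ⱽ[ a ] (deg a * (2 * g (w a) + D)) + 2 * ∑ⱽ[ a ] (deg a * g (w a)) ≤
    4 * D * (W + 5 * k) + ∑ⱽ[ a ] (deg a * (degIn a * g (w a)))
  bridge-bound {k} count bound = begin
    4 * ∑ⱽ[ a ] (deg a * (2 * g (w a) + D)) + 2 * ∑ⱽ[ a ] (deg a * g (w a))
      ≡⟨ cong₂ _+_ (∑-*ˡ V 4 _) (∑-*ˡ V 2 _) ⟨
    ∑ⱽ[ a ] (4 * (deg a * (2 * g (w a) + D))) + ∑ⱽ[ a ] (2 * (deg a * g (w a)))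
      ≡⟨ ∑-+ V _ _ ⟨
    ∑ⱽ[ a ] (4 * (deg a * (2 * g (w a) + D)) + 2 * (deg a * g (w a)))
      ≡⟨ ∑-cong V (λ a → lem₁ (deg a) (g (w a)) D) ⟩
    ∑ⱽ[ a ] (deg a * (10 * g (w a) + 4 * D))
      ≡⟨ ∑-by-class E deg _ (λ e → cong (λ z → 10 * g z + 4 * D) (classSize-cong E e)) ⟩
    ∑ⱽ[ u ] (L u * (degIn u * (10 * g (w u) + 4 * D)))
      ≤⟨ ∑-mono V (λ u → *-monoʳ-≤ (L u) (point u)) ⟩
    ∑ⱽ[ u ] (L u * (4 * D * w u + 20 * D + degIn u * (degIn u * g (w u))))
      ≡⟨ ∑-cong V (λ u → lem₂ (L u) D (w u) (degIn u * (degIn u * g (w u)))) ⟩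
    ∑ⱽ[ u ] (4 * D * (L u * w u) + 20 * D * L u + L u * (degIn u * (degIn u * g (w u))))
      ≡⟨ trans (∑-+ V _ _) (cong₂ _+_ (trans (∑-+ V _ _) (cong₂ _+_ (∑-*ˡ V (4 * D) _) (∑-*ˡ V (20 * D) _)))
           (sym (∑-by-class E deg _ (λ e → cong₂ (λ m z → m * g z) (degIn-cong e) (classSize-cong E e))))) ⟩
    4 * D * ∑ⱽ[ u ] (L u * w u) + 20 * D * ∑ⱽ[ u ] L u + ∑ⱽ[ a ] (deg a * (degIn a * g (w a)))
      ≡⟨ cong (_+ (∑ⱽ[ a ] (deg a * (degIn a * g (w a))))) (trans (cong₂ (λ s t → 4 * D * s + 20 * D * t) (∑-classSize E) count) (lem₃ D W k)) ⟩
    4 * D * (W + 5 * k) + ∑ⱽ[ a ] (deg a * (degIn a * g (w a))) ∎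
    where
    open ≤-Reasoning
    lem₁ : ∀ d g D → 4 * (d * (2 * g + D)) + 2 * (d * g) ≡ d * (10 * g + 4 * D)
    lem₁ = solve-∀
    lem₂ : ∀ l D w m → l * (4 * D * w + 20 * D + m) ≡ 4 * D * (l * w) + 20 * D * l + l * m
    lem₂ = solve-∀
    lem₃ : ∀ D W k → 4 * D * W + 20 * D * k ≡ 4 * D * (W + 5 * k)
    lem₃ = solve-∀
    -- The square (2w − m)² is non-negative, written for e = 2w − m.
    square : ∀ m e g w → 2 * w ≡ m + e →
      m * (10 * g + 4 * (g * w)) + (e * e + 10 * e) * g ≡ 4 * (g * w) * w + 20 * (g * w) + m * (m * g)
    square m e g w h = trans (left m e g w) (trans (cong (λ z → g * (10 * m + 2 * m * z + (e * e + 10 * e))) h)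
      (trans (middle m e g) (trans (cong (λ z → g * (z * z + 10 * z + m * m)) (sym h)) (right m g w))))
      where
      left : ∀ m e g w → m * (10 * g + 4 * (g * w)) + (e * e + 10 * e) * g ≡ g * (10 * m + 2 * m * (2 * w) + (e * e + 10 * e))
      left = solve-∀
      middle : ∀ m e g → g * (10 * m + 2 * m * (m + e) + (e * e + 10 * e)) ≡ g * ((m + e) * (m + e) + 10 * (m + e) + m * m)
      middle = solve-∀
      right : ∀ m g w → g * (2 * w * (2 * w) + 10 * (2 * w) + m * m) ≡ 4 * (g * w) * w + 20 * (g * w) + m * (m * g)
      right = solve-∀
    point : ∀ u → degIn u * (10 * g (w u) + 4 * D) ≤ 4 * D * w u + 20 * D + degIn u * (degIn u * g (w u))
    point u = subst (λ z → degIn u * (10 * g (w u) + 4 * z) ≤ 4 * z * w u + 20 * z + degIn u * (degIn u * g (w u)))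
      (g-share (w u) (classSize≥1 E u) (∑ⱽ-𝟙≤W _))
      (≤-trans (m≤m+n _ _) (≤-reflexive (square (degIn u) _ (g (w u)) (w u)
        (sym (m+[n∸m]≡n (≤-trans (m≤m+n (degIn u) 2) (bound u)))))))

  -- By symmetry in `a` and `b` the marked vertex `c` may be put in the class of `a`, at the price
  -- of a factor 2. Then everything depends on `a` only through the class of `c`, and the choices of
  -- `a` give the factor `w c`.
  ∑-either-side : ∑ⱽ[ a ] ∑ⱽ[ b ] (apart a b * ∑ⱽ[ c ] ((𝟙 (r a c) + 𝟙 (r b c)) * (deg c * g (w a + w b)))) ≡
    2 * ∑ⱽ[ c ] (deg c * ∑ⱽ[ b ] (apart c b * (w c * g (w c + w b))))
  ∑-either-side = begin
    ∑ⱽ[ a ] ∑ⱽ[ b ] (apart a b * ∑ⱽ[ c ] ((𝟙 (r a c) + 𝟙 (r b c)) * (deg c * g (w a + w b))))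
      ≡⟨ ∑-cong V (λ a → trans (∑-cong V λ b → trans (sym (∑-*ˡ V (apart a b) _)) (trans (∑-cong V λ c →
           lem₁ (apart a b) (𝟙 (r a c)) (𝟙 (r b c)) (deg c) (g (w a + w b))) (∑-+ V _ _))) (∑-+ V _ _)) ⟩
    ∑ⱽ[ a ] (∑ⱽ[ b ] ∑ⱽ[ c ] (𝟙 (r a c) * (deg c * θ a b)) + ∑ⱽ[ b ] ∑ⱽ[ c ] (𝟙 (r b c) * (deg c * θ a b)))
      ≡⟨ ∑-+ V _ _ ⟩
    ∑ⱽ[ a ] ∑ⱽ[ b ] ∑ⱽ[ c ] (𝟙 (r a c) * (deg c * θ a b)) + ∑ⱽ[ a ] ∑ⱽ[ b ] ∑ⱽ[ c ] (𝟙 (r b c) * (deg c * θ a b))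
      ≡⟨ cong (∑ⱽ[ a ] ∑ⱽ[ b ] ∑ⱽ[ c ] (𝟙 (r a c) * (deg c * θ a b)) +_) (trans (∑-swap V V _)
           (∑-cong V λ a → ∑-cong V λ b → ∑-cong V λ c → cong (λ z → 𝟙 (r a c) * (deg c * z)) (θ-sym b a))) ⟩
    ∑ⱽ[ a ] ∑ⱽ[ b ] ∑ⱽ[ c ] (𝟙 (r a c) * (deg c * θ a b)) + ∑ⱽ[ a ] ∑ⱽ[ b ] ∑ⱽ[ c ] (𝟙 (r a c) * (deg c * θ a b))
      ≡⟨ double (∑ⱽ[ a ] ∑ⱽ[ b ] ∑ⱽ[ c ] (𝟙 (r a c) * (deg c * θ a b))) ⟩
    2 * ∑ⱽ[ a ] ∑ⱽ[ b ] ∑ⱽ[ c ] (𝟙 (r a c) * (deg c * θ a b))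
      ≡⟨ cong (2 *_) (trans (∑-cong V λ a → ∑-swap V V _) (trans (∑-swap V V _) (∑-cong V collect))) ⟩
    2 * ∑ⱽ[ c ] (deg c * ∑ⱽ[ b ] (apart c b * (w c * g (w c + w b)))) ∎
    where
    open ≡-Reasoning
    double : ∀ n → n + n ≡ 2 * n
    double = solve-∀
    lem₁ : ∀ s p q d t → s * ((p + q) * (d * t)) ≡ p * (d * (s * t)) + q * (d * (s * t))
    lem₁ = solve-∀
    lem₂ : ∀ s w d t → w * (d * (s * t)) ≡ d * (s * (w * t))
    lem₂ = solve-∀
    collect : ∀ c → ∑ⱽ[ a ] ∑ⱽ[ b ] (𝟙 (r a c) * (deg c * θ a b)) ≡ deg c * ∑ⱽ[ b ] (apart c b * (w c * g (w c + w b)))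
    collect c = trans (∑-swap V V _) (trans (∑-cong V λ b → trans
        (trans (∑-cong V λ a → trans (guard (r a c) (λ e → cong (deg c *_) (θ-cong₁ b e)))
            (cong (λ t → 𝟙 t * (deg c * θ c b)) (symm a c)))
          (∑-*ʳ V (deg c * θ c b) _))
        (lem₂ (apart c b) (w c) (deg c) (g (w c + w b))))
      (∑-*ˡ V (deg c) _))

  -- Both sides count triples of pairwise separated vertices, weighted by the component of one of them.
  ∑-triples : ∑ⱽ[ p ] ∑ⱽ[ q ] (apart p q * ∑ⱽ[ v ] (apart p v * apart q v * ((w p + w q) * g (w p + w q + w v)))) ≡
    2 * ∑ⱽ[ p ] ∑ⱽ[ q ] (apart p q * ∑ⱽ[ v ] (apart p v * apart q v * (g (w p + w q + w v) * w v)))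
  ∑-triples = begin
    ∑ⱽ[ p ] ∑ⱽ[ q ] (apart p q * ∑ⱽ[ v ] (apart p v * apart q v * ((w p + w q) * g (w p + w q + w v))))
      ≡⟨ ∑-cong V (λ p → ∑-cong V λ q → trans (sym (∑-*ˡ V (apart p q) _)) (∑-cong V λ v →
           lem₁ (apart p q) (apart p v) (apart q v) (w p) (w q) (g (w p + w q + w v)))) ⟩
    ∑ⱽ[ p ] ∑ⱽ[ q ] ∑ⱽ[ v ] (τ p q v * w p + τ p q v * w q)
      ≡⟨ trans (∑-cong V λ p → trans (∑-cong V λ q → ∑-+ V _ _) (∑-+ V _ _)) (∑-+ V _ _) ⟩
    ∑ⱽ[ p ] ∑ⱽ[ q ] ∑ⱽ[ v ] (τ p q v * w p) + ∑ⱽ[ p ] ∑ⱽ[ q ] ∑ⱽ[ v ] (τ p q v * w q)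
      ≡⟨ cong₂ _+_ first second ⟩
    X + X
      ≡⟨ double X ⟩
    2 * X
      ≡⟨ cong (2 *_) (∑-cong V λ p → ∑-cong V λ q → trans (∑-cong V λ v →
           lem₂ (apart p q) (apart p v) (apart q v) (w v) (g (w p + w q + w v))) (∑-*ˡ V (apart p q) _)) ⟩
    2 * ∑ⱽ[ p ] ∑ⱽ[ q ] (apart p q * ∑ⱽ[ v ] (apart p v * apart q v * (g (w p + w q + w v) * w v))) ∎
    where
    open ≡-Reasoning
    τ : Fin W → Fin W → Fin W → ℕ
    τ p q v = apart p q * (apart p v * apart q v) * g (w p + w q + w v)
    X : ℕ
    X = ∑ⱽ[ p ] ∑ⱽ[ q ] ∑ⱽ[ v ] (τ p q v * w v)
    double : ∀ n → n + n ≡ 2 * n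
    double = solve-∀
    lem₁ : ∀ a b c x y t → a * (b * c * ((x + y) * t)) ≡ a * (b * c) * t * x + a * (b * c) * t * y
    lem₁ = solve-∀
    lem₂ : ∀ a b c x t → a * (b * c) * t * x ≡ a * (b * c * (t * x))
    lem₂ = solve-∀
    swap₁₂ : ∀ p q v → τ p q v ≡ τ q p v
    swap₁₂ p q v = cong₂ (λ s t → s * g (t + w v))
      (cong₂ _*_ (apart-sym p q) (*-comm (apart p v) (apart q v))) (+-comm (w p) (w q))
    swap₂₃ : ∀ p q v → τ p q v ≡ τ p v q
    swap₂₃ p q v = cong₂ (λ s t → s * g t)
      (trans (perm (apart p q) (apart p v) (apart q v)) (cong (λ z → apart p v * (apart p q * z)) (apart-sym q v)))
      (perm₊ (w p) (w q) (w v))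
      where
      perm : ∀ a b c → a * (b * c) ≡ b * (a * c)
      perm = solve-∀
      perm₊ : ∀ a b c → a + b + c ≡ a + c + b
      perm₊ = solve-∀
    second : ∑ⱽ[ p ] ∑ⱽ[ q ] ∑ⱽ[ v ] (τ p q v * w q) ≡ X
    second = ∑-cong V λ p → trans (∑-swap V V _) (∑-cong V λ v → ∑-cong V λ q → cong (_* w q) (swap₂₃ p q v))
    first : ∑ⱽ[ p ] ∑ⱽ[ q ] ∑ⱽ[ v ] (τ p q v * w p) ≡ X
    first = trans (∑-swap V V _) (trans (∑-cong V λ q → ∑-cong V λ p → ∑-cong V λ v → cong (_* w p) (swap₁₂ p q v)) second)

-- The inequality between consecutive levels

module Levels {W} (𝒜 : Class W) (alterable : BridgeAlterable 𝒜) where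
  open Exchange 𝒜 alterable public

  private
    V : List (Fin W)
    V = allFin W

  ∑ᴸ-cong : ∀ j {Ψ Φ : Graph W → ℕ} → (∀ G → Simple G → classCount (reachable G) ≡ j → Ψ G ≡ Φ G) → ∑ᴸ j Ψ ≡ ∑ᴸ j Φ
  ∑ᴸ-cong j h = ∑-cong (allGraphs W) λ G → guard (inLevel j G)
    (λ e → h G (inLevel⇒Simple {j} {G} e) (inLevel⇒classCount {j} {G} e))

  ∑ᴸ-mono : ∀ j {Ψ Φ : Graph W → ℕ} → (∀ G → Simple G → classCount (reachable G) ≡ j → Ψ G ≤ Φ G) → ∑ᴸ j Ψ ≤ ∑ᴸ j Φ
  ∑ᴸ-mono j h = ∑-mono (allGraphs W) λ G → guard-≤ (inLevel j G)
    (λ e → h G (inLevel⇒Simple {j} {G} e) (inLevel⇒classCount {j} {G} e))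

  ∑ᴸ-+ : ∀ j Ψ Φ → ∑ᴸ j (λ G → Ψ G + Φ G) ≡ ∑ᴸ j Ψ + ∑ᴸ j Φ
  ∑ᴸ-+ j Ψ Φ = trans (∑-cong (allGraphs W) λ G → *-distribˡ-+ (𝟙 (inLevel j G)) (Ψ G) (Φ G)) (∑-+ (allGraphs W) _ _)

  ∑ᴸ-*ˡ : ∀ j c Ψ → ∑ᴸ j (λ G → c * Ψ G) ≡ c * ∑ᴸ j Ψ
  ∑ᴸ-*ˡ j c Ψ = trans (∑-cong (allGraphs W) λ G → lem (𝟙 (inLevel j G)) c (Ψ G)) (∑-*ˡ (allGraphs W) c _)
    where
    lem : ∀ l c x → l * (c * x) ≡ c * (l * x)
    lem = solve-∀

  levelSize : ℕ → ℕ
  levelSize j = ∑[ G ∈ allGraphs W ] 𝟙 (inLevel j G)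

  ∑ᴸ-const : ∀ j c → ∑ᴸ j (λ _ → c) ≡ c * levelSize j
  ∑ᴸ-const j c = trans (∑-*ʳ (allGraphs W) c _) (*-comm _ c)

  module _ (g : ℕ → ℕ) (D : ℕ) (g-share : ∀ s → 1 ≤ s → s ≤ W → g s * s ≡ D) (j : ℕ) where
    private
      comp = componentSize {W}
      deg  = bridgeDegree {W}

      apart : Graph W → Fin W → Fin W → ℕ
      apart G a b = 𝟙 (not (reachable G a b))

      module One {G : Graph W} (s : Simple G) = Weighted (reachable-equiv s) (deg G) g D g-share

      ∑-degree : ∀ G (f : Fin W → ℕ) → ∑ⱽ[ x ] (deg G x * f x) ≡ ∑ⱽ[ x ] ∑ⱽ[ y ] (𝟙 (isBridge G x y) * f x)
      ∑-degree G f = ∑-cong V λ x → sym (∑-*ʳ V (f x) _)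

      -- `B₂` counts pairs of bridges of G lying in one component, and `S₄` the pairs of a bridge
      -- `ab` and a bridge of G - ab inside the former component of `a`. `S₃` lives one level
      -- higher: it counts a bridge of H together with a vertex outside the component of that
      -- bridge.
      A₁ B₁ B₂ S₃ S₄ : ℕ
      A₁ = ∑ᴸ j (λ G → ∑ⱽ[ a ] (deg G a * (2 * g (comp G a) + D)))
      B₁ = ∑ᴸ j (λ G → ∑ⱽ[ a ] (deg G a * g (comp G a)))
      B₂ = ∑ᴸ j (λ G → ∑ⱽ[ a ] (deg G a * (bridgesIn G a * g (comp G a))))
      S₃ = ∑ᴸ (suc j) (λ H → ∑ⱽ[ p ] (deg H p * ∑ⱽ[ v ] (apart H p v * (g (comp H p + comp H v) * comp H v))))
      S₄ = ∑ᴸ j (λ G → ∑ⱽ[ a ] ∑ⱽ[ b ] (𝟙 (isBridge G a b) *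
             ∑ⱽ[ c ] (𝟙 (reachable G a c) * (deg (toggle a b G) c * g (comp G a)))))

      A₁-exchange : A₁ ≡ ∑ᴸ (suc j) (λ H → ∑ⱽ[ x ] ∑ⱽ[ y ] (apart H x y * (2 * g (comp H x + comp H y) + D)))
      A₁-exchange = trans (∑ᴸ-cong j (λ G _ _ → ∑-degree G _))
        (exchange j _ _ λ G x y s b → cong (λ z → 2 * g z + D) (Merge.classSize-joined (bridge-merge s b)))

      X₃ X₄ : Graph W → ℕ
      X₃ K = ∑ⱽ[ p ] ∑ⱽ[ q ] (apart K p q *
        ∑ⱽ[ v ] (apart K p v * apart K q v * (g (comp K p + comp K q + comp K v) * comp K v)))
      X₄ K = ∑ⱽ[ p ] ∑ⱽ[ q ] (apart K p q *
        ∑ⱽ[ v ] (apart K p v * apart K q v * ((comp K p + comp K q) * g (comp K p + comp K q + comp K v))))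

      -- Deletes the bridge `pq` next to a vertex `v` of another component: the component of `p`
      -- becomes two pieces, the one of `v` is untouched. `f` takes the two sizes separately because
      -- `S₃` weights by one of them and `S₄` by the other.
      exchange-third : (f : ℕ → ℕ → ℕ) →
        ∑ᴸ (suc j) (λ H → ∑ⱽ[ p ] (deg H p * ∑ⱽ[ v ] (apart H p v * f (comp H p) (comp H v)))) ≡
        ∑ᴸ (suc (suc j)) (λ K → ∑ⱽ[ p ] ∑ⱽ[ q ] (apart K p q *
          ∑ⱽ[ v ] (apart K p v * apart K q v * f (comp K p + comp K q) (comp K v))))
      exchange-third f = trans (∑ᴸ-cong (suc j) (λ H _ _ → ∑-degree H _))
        (exchange (suc j) _ _ λ H p q s b → let open Merge (bridge-merge s b) in ∑-cong V λ v →
          trans (guard (not (reachable H p v)) (λ e → cong₂ f classSize-joined (classSize-other v (not-true e))))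
            (cong (_* f (comp (toggle p q H) p + comp (toggle p q H) q) (comp (toggle p q H) v)) (𝟙-notJoined v)))

      S₃-exchange : S₃ ≡ ∑ᴸ (suc (suc j)) X₃
      S₃-exchange = exchange-third (λ m n → g (m + n) * n)

      S₄-exchange : S₄ ≡ 2 * ∑ᴸ (suc (suc j)) X₄
      S₄-exchange = begin
        S₄
          ≡⟨ exchange j _ (λ H a b → ∑ⱽ[ c ] ((𝟙 (reachable H a c) + 𝟙 (reachable H b c)) * (deg H c * g (comp H a + comp H b))))
               (λ G a b s e → let open Merge (bridge-merge s e) in ∑-cong V λ c →
                 cong₂ (λ i n → i * (deg (toggle a b G) c * g n)) (𝟙-joined c) classSize-joined) ⟩
        ∑ᴸ (suc j) (λ H → ∑ⱽ[ a ] ∑ⱽ[ b ] (apart H a b *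
          ∑ⱽ[ c ] ((𝟙 (reachable H a c) + 𝟙 (reachable H b c)) * (deg H c * g (comp H a + comp H b)))))
          ≡⟨ ∑ᴸ-cong (suc j) (λ H s _ → One.∑-either-side s) ⟩
        ∑ᴸ (suc j) (λ H → 2 * ∑ⱽ[ c ] (deg H c * ∑ⱽ[ b ] (apart H c b * (comp H c * g (comp H c + comp H b)))))
          ≡⟨ ∑ᴸ-*ˡ (suc j) 2 _ ⟩
        2 * ∑ᴸ (suc j) (λ H → ∑ⱽ[ c ] (deg H c * ∑ⱽ[ b ] (apart H c b * (comp H c * g (comp H c + comp H b)))))
          ≡⟨ cong (2 *_) (exchange-third (λ m n → m * g (m + n))) ⟩
        2 * ∑ᴸ (suc (suc j)) X₄ ∎
        where open ≡-Reasoning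

      -- One factor 2 because the second bridge may lie on either side of the first, another
      -- because, by symmetry among the three pieces, two of the sizes together contribute twice as
      -- much as the third. Being an equality, it lets `S₃` cancel without an estimate.
      S₄≡4S₃ : S₄ ≡ 4 * S₃
      S₄≡4S₃ = trans S₄-exchange (trans (cong (2 *_) (trans (∑ᴸ-cong (suc (suc j)) (λ K s _ → One.∑-triples s))
        (trans (∑ᴸ-*ˡ (suc (suc j)) 2 X₃) (cong (2 *_) (sym S₃-exchange))))) (sym (*-assoc 2 2 S₃)))

      lower : 2 * (j * W * D) * levelSize (suc j) + S₃ ≤ A₁
      lower = begin
        2 * (j * W * D) * levelSize (suc j) + S₃
          ≡⟨ cong (_+ S₃) (∑ᴸ-const (suc j) (2 * (j * W * D))) ⟨
        ∑ᴸ (suc j) (λ _ → 2 * (j * W * D)) + S₃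
          ≡⟨ ∑ᴸ-+ (suc j) _ _ ⟨
        ∑ᴸ (suc j) (λ H → 2 * (j * W * D) +
          ∑ⱽ[ p ] (deg H p * ∑ⱽ[ v ] (apart H p v * (g (comp H p + comp H v) * comp H v))))
          ≤⟨ ∑ᴸ-mono (suc j) (λ H s count → One.separated-bound s count (bridgesIn-bound s)) ⟩
        ∑ᴸ (suc j) (λ H → ∑ⱽ[ x ] ∑ⱽ[ y ] (apart H x y * (2 * g (comp H x + comp H y) + D)))
          ≡⟨ A₁-exchange ⟨
        A₁ ∎
        where open ≤-Reasoning

      -- Every second bridge of G other than `ab` is still a bridge of G - ab. The term `2 * B₁`
      -- pays for the case that it is `ab` itself, in either orientation.
      persist : B₂ ≤ S₄ + 2 * B₁
      persist = begin
        B₂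
          ≤⟨ ∑ᴸ-mono j (λ G s _ → one G s) ⟩
        ∑ᴸ j (λ G → (∑ⱽ[ a ] ∑ⱽ[ b ] (𝟙 (isBridge G a b) *
             ∑ⱽ[ c ] (𝟙 (reachable G a c) * (deg (toggle a b G) c * g (comp G a)))))
          + 2 * ∑ⱽ[ a ] (deg G a * g (comp G a)))
          ≡⟨ trans (∑ᴸ-+ j _ _) (cong (S₄ +_) (∑ᴸ-*ˡ j 2 _)) ⟩
        S₄ + 2 * B₁ ∎
        where
        open ≤-Reasoning
        lem : ∀ i n m → i * ((2 + n) * m) ≡ i * (n * m) + 2 * (i * m)
        lem = solve-∀
        one : ∀ G → Simple G → ∑ⱽ[ a ] (deg G a * (bridgesIn G a * g (comp G a))) ≤
          (∑ⱽ[ a ] ∑ⱽ[ b ] (𝟙 (isBridge G a b) * ∑ⱽ[ c ] (𝟙 (reachable G a c) * (deg (toggle a b G) c * g (comp G a)))))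
          + 2 * ∑ⱽ[ a ] (deg G a * g (comp G a))
        one G s = begin
          ∑ⱽ[ a ] (deg G a * (bridgesIn G a * g (comp G a)))
            ≡⟨ ∑-degree G _ ⟩
          ∑ⱽ[ a ] ∑ⱽ[ b ] (𝟙 (isBridge G a b) * (bridgesIn G a * g (comp G a)))
            ≤⟨ ∑-mono V (λ a → ∑-mono V λ b → guard-≤ (isBridge G a b) λ e →
                 *-monoˡ-≤ (g (comp G a)) (bridgeDegree-delete s (bridge-adj G e) (reachable G a))) ⟩
          ∑ⱽ[ a ] ∑ⱽ[ b ] (𝟙 (isBridge G a b) * ((2 + ∑ⱽ[ c ] (𝟙 (reachable G a c) * deg (toggle a b G) c)) * g (comp G a)))
            ≡⟨ ∑-cong V (λ a → trans (∑-cong V λ b → trans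
                 (lem (𝟙 (isBridge G a b)) (∑ⱽ[ c ] (𝟙 (reachable G a c) * deg (toggle a b G) c)) (g (comp G a)))
                 (cong (λ z → 𝟙 (isBridge G a b) * z + 2 * (𝟙 (isBridge G a b) * g (comp G a)))
                   (trans (sym (∑-*ʳ V (g (comp G a)) _)) (∑-cong V λ c → *-assoc (𝟙 (reachable G a c)) _ _))))
                 (trans (∑-+ V _ _) (cong ((∑ⱽ[ b ] (𝟙 (isBridge G a b) * ∑ⱽ[ c ] (𝟙 (reachable G a c) * (deg (toggle a b G) c * g (comp G a))))) +_)
                   (∑-*ˡ V 2 _)))) ⟩
          ∑ⱽ[ a ] ((∑ⱽ[ b ] (𝟙 (isBridge G a b) * ∑ⱽ[ c ] (𝟙 (reachable G a c) * (deg (toggle a b G) c * g (comp G a)))))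
            + 2 * ∑ⱽ[ b ] (𝟙 (isBridge G a b) * g (comp G a)))
            ≡⟨ trans (∑-+ V _ _) (cong ((∑ⱽ[ a ] ∑ⱽ[ b ] (𝟙 (isBridge G a b) *
                 ∑ⱽ[ c ] (𝟙 (reachable G a c) * (deg (toggle a b G) c * g (comp G a))))) +_)
                 (trans (∑-*ˡ V 2 _) (cong (2 *_) (sym (∑-degree G _))))) ⟩
          (∑ⱽ[ a ] ∑ⱽ[ b ] (𝟙 (isBridge G a b) * ∑ⱽ[ c ] (𝟙 (reachable G a c) * (deg (toggle a b G) c * g (comp G a)))))
            + 2 * ∑ⱽ[ a ] (deg G a * g (comp G a)) ∎

      upper : 4 * A₁ + 2 * B₁ ≤ 4 * D * (W + 5 * j) * levelSize j + B₂
      upper = begin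
        4 * A₁ + 2 * B₁
          ≡⟨ cong₂ _+_ (∑ᴸ-*ˡ j 4 _) (∑ᴸ-*ˡ j 2 _) ⟨
        ∑ᴸ j (λ G → 4 * ∑ⱽ[ a ] (deg G a * (2 * g (comp G a) + D))) + ∑ᴸ j (λ G → 2 * ∑ⱽ[ a ] (deg G a * g (comp G a)))
          ≡⟨ ∑ᴸ-+ j _ _ ⟨
        ∑ᴸ j (λ G → 4 * ∑ⱽ[ a ] (deg G a * (2 * g (comp G a) + D)) + 2 * ∑ⱽ[ a ] (deg G a * g (comp G a)))
          ≤⟨ ∑ᴸ-mono j (λ G s count → One.bridge-bound s count (bridgesIn-bound s)) ⟩
        ∑ᴸ j (λ G → 4 * D * (W + 5 * j) + ∑ⱽ[ a ] (deg G a * (bridgesIn G a * g (comp G a))))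
          ≡⟨ trans (∑ᴸ-+ j _ _) (cong (_+ B₂) (∑ᴸ-const j _)) ⟩
        4 * D * (W + 5 * j) * levelSize j + B₂ ∎
        where open ≤-Reasoning

    -- Four times `lower`, then `upper`, then `persist`. Since `S₄` is `4 * S₃`, the same quantity
    -- `S₄ + 2 * B₁` stands on both sides and is cancelled.
    level-step-scaled : 4 * D * (2 * (j * W) * levelSize (suc j)) ≤ 4 * D * ((W + 5 * j) * levelSize j)
    level-step-scaled = +-cancelʳ-≤ (S₄ + 2 * B₁) _ _ (begin
      4 * D * (2 * (j * W) * levelSize (suc j)) + (S₄ + 2 * B₁)
        ≡⟨ cong (λ z → 4 * D * (2 * (j * W) * levelSize (suc j)) + (z + 2 * B₁)) S₄≡4S₃ ⟩
      4 * D * (2 * (j * W) * levelSize (suc j)) + (4 * S₃ + 2 * B₁)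
        ≡⟨ lem D (j * W) (levelSize (suc j)) S₃ B₁ ⟩
      4 * (2 * (j * W * D) * levelSize (suc j) + S₃) + 2 * B₁
        ≤⟨ +-monoˡ-≤ (2 * B₁) (*-monoʳ-≤ 4 lower) ⟩
      4 * A₁ + 2 * B₁
        ≤⟨ upper ⟩
      4 * D * (W + 5 * j) * levelSize j + B₂
        ≤⟨ +-monoʳ-≤ (4 * D * (W + 5 * j) * levelSize j) persist ⟩
      4 * D * (W + 5 * j) * levelSize j + (S₄ + 2 * B₁)
        ≡⟨ cong (_+ (S₄ + 2 * B₁)) (*-assoc (4 * D) (W + 5 * j) (levelSize j)) ⟩
      4 * D * ((W + 5 * j) * levelSize j) + (S₄ + 2 * B₁) ∎)
      where
      open ≤-Reasoning
      lem : ∀ D x l s b → 4 * D * (2 * x * l) + (4 * s + 2 * b) ≡ 4 * (2 * (x * D) * l + s) + 2 * b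
      lem = solve-∀

  private
    -- D/s with D = W!, which is divisible by every possible component size. The value at 0 is a
    -- default, as no component is empty.
    share : ℕ → ℕ
    share zero    = 0
    share (suc s) = W ! ℕ./ suc s

    share-spec : ∀ s → 1 ≤ s → s ≤ W → share s * s ≡ W !
    share-spec (suc s) _ s≤W = m/n*n≡m (∣-trans (m∣m*n (s !)) (m≤n⇒m!∣n! s≤W))

  level-step : ∀ j → 2 * (j * W) * levelSize (suc j) ≤ (W + 5 * j) * levelSize j
  level-step j = *-cancelˡ-≤ (4 * W !) ⦃ m*n≢0 4 (W !) ⦃ _ ⦄ ⦃ W !≢0 ⦄ ⦄ (level-step-scaled share (W !) share-spec j)

-- The negative binomial series

multichoose : ℕ → ℕ → ℕ
multichoose a       zero    = 1
multichoose zero    (suc j) = 1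
multichoose (suc a) (suc j) = multichoose (suc a) j + multichoose a (suc j)

multichoose-absorb : ∀ a j → suc j * multichoose a (suc j) ≡ (a + suc j) * multichoose a j
multichoose-absorb zero    zero    = refl
multichoose-absorb zero    (suc j) = refl
multichoose-absorb (suc a) zero    = trans (lem₁ (multichoose a 1)) (trans (cong (1 +_) (multichoose-absorb a 0)) (lem₂ a))
  where
  lem₁ : ∀ x → 1 * (1 + x) ≡ 1 + 1 * x
  lem₁ = solve-∀
  lem₂ : ∀ a → 1 + (a + 1) * 1 ≡ (suc a + 1) * 1
  lem₂ = solve-∀
multichoose-absorb (suc a) (suc j) = trans (lem₁ j (multichoose (suc a) (suc j)) (multichoose a (suc (suc j))))
  (trans (cong₂ (λ x y → multichoose (suc a) (suc j) + x + y) (multichoose-absorb (suc a) j) (multichoose-absorb a (suc j)))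
    (lem₂ a j (multichoose (suc a) j) (multichoose a (suc j))))
  where
  lem₁ : ∀ j x y → suc (suc j) * (x + y) ≡ x + suc j * x + suc (suc j) * y
  lem₁ = solve-∀
  lem₂ : ∀ a j p q → p + q + (suc a + suc j) * p + (a + suc (suc j)) * q ≡ (suc a + suc (suc j)) * (p + q)
  lem₂ = solve-∀

-- partialSeries b a N = Σ_{j<N} multichoose a j · (1+b)^(N−1−j)
partialSeries : ℕ → ℕ → ℕ → ℕ
partialSeries b a zero    = 0
partialSeries b a (suc N) = suc b * partialSeries b a N + multichoose a N

partialSeries-zero : ∀ b N → b * partialSeries b 0 N + 1 ≡ suc b ^ N
partialSeries-zero b zero    = cong (_+ 1) (*-zeroʳ b)
partialSeries-zero b (suc N) = trans (cong (λ z → b * (suc b * partialSeries b 0 N + z) + 1) (one N))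
  (trans (lem b (partialSeries b 0 N)) (cong (suc b *_) (partialSeries-zero b N)))
  where
  one : ∀ j → multichoose 0 j ≡ 1
  one zero    = refl
  one (suc j) = refl
  lem : ∀ b x → b * (suc b * x + 1) + 1 ≡ suc b * (b * x + 1)
  lem = solve-∀

partialSeries-suc : ∀ b a N → b * partialSeries b (suc a) (suc N) + multichoose (suc a) N ≡ suc b * partialSeries b a (suc N)
partialSeries-suc b a zero    = lem b
  where
  lem : ∀ b → b * (suc b * 0 + 1) + 1 ≡ suc b * (suc b * 0 + 1)
  lem = solve-∀
partialSeries-suc b a (suc N) = trans (lem₁ b (partialSeries b (suc a) (suc N)) (multichoose (suc a) N) (multichoose a (suc N)))
  (cong (λ z → suc b * (z + multichoose a (suc N))) (partialSeries-suc b a N))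
  where
  lem₁ : ∀ b x p q → b * (suc b * x + (p + q)) + (p + q) ≡ suc b * ((b * x + p) + q)
  lem₁ = solve-∀

partialSeries-≤ : ∀ b a N → b * partialSeries b (suc a) N ≤ suc b * partialSeries b a N
partialSeries-≤ b a zero    = ≤-reflexive (trans (*-zeroʳ b) (sym (*-zeroʳ (suc b))))
partialSeries-≤ b a (suc N) = m+n≤o⇒m≤o _ (≤-reflexive (partialSeries-suc b a N))

partialSeries-bound : ∀ b a N → b ^ suc a * partialSeries b a N ≤ suc b ^ (a + N)
partialSeries-bound b zero N = m+n≤o⇒m≤o _ (≤-reflexive
  (trans (cong (λ z → z * partialSeries b 0 N + 1) (*-identityʳ b)) (partialSeries-zero b N)))
partialSeries-bound b (suc a) N = begin
  b ^ suc (suc a) * partialSeries b (suc a) N      ≡⟨ lem₁ b (b ^ suc a) (partialSeries b (suc a) N) ⟩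
  b ^ suc a * (b * partialSeries b (suc a) N)      ≤⟨ *-monoʳ-≤ (b ^ suc a) (partialSeries-≤ b a N) ⟩
  b ^ suc a * (suc b * partialSeries b a N)        ≡⟨ lem₂ (b ^ suc a) (suc b) (partialSeries b a N) ⟩
  suc b * (b ^ suc a * partialSeries b a N)        ≤⟨ *-monoʳ-≤ (suc b) (partialSeries-bound b a N) ⟩
  suc b ^ (suc a + N)                              ∎
  where
  open ≤-Reasoning
  lem₁ : ∀ b x y → b * x * y ≡ x * (b * y)
  lem₁ = solve-∀
  lem₂ : ∀ x b y → x * (b * y) ≡ b * (x * y)
  lem₂ = solve-∀

sumUpTo : ℕ → (ℕ → ℕ) → ℕ
sumUpTo zero    f = 0
sumUpTo (suc N) f = sumUpTo N f + f N

module _ (F : ℕ → ℕ) (W : ℕ) (step : ∀ j → 2 * (j * W) * F (suc j) ≤ (W + 5 * j) * F j)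
  (m b : ℕ) (2m≡1+b : 2 * m ≡ suc b) (5m≤W : 5 * m ≤ W) (W>0 : ℕ.NonZero W) where

  -- The hypothesis scaled by M/W: as 5M ≤ W, the factor W + 5(j + 1) becomes at most M + j + 1.
  -- This is exactly the ratio by which `multichoose m` grows, see `multichoose-absorb`.
  step′ : ∀ j → suc j * (suc b * F (suc (suc j))) ≤ (m + suc j) * F (suc j)
  step′ j = *-cancelˡ-≤ W ⦃ W>0 ⦄ (begin
    W * (suc j * (suc b * F (suc (suc j))))        ≡⟨ cong (λ z → W * (suc j * (z * F (suc (suc j))))) 2m≡1+b ⟨
    W * (suc j * (2 * m * F (suc (suc j))))        ≡⟨ lem₁ W (suc j) m (F (suc (suc j))) ⟩
    m * (2 * (suc j * W) * F (suc (suc j)))        ≤⟨ *-monoʳ-≤ m (step (suc j)) ⟩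
    m * ((W + 5 * suc j) * F (suc j))              ≡⟨ lem₂ m W (suc j) (F (suc j)) ⟩
    (W * m + 5 * m * suc j) * F (suc j)            ≤⟨ *-monoˡ-≤ (F (suc j)) (+-monoʳ-≤ (W * m) (*-monoˡ-≤ (suc j) 5m≤W)) ⟩
    (W * m + W * suc j) * F (suc j)                ≡⟨ lem₃ W m (suc j) (F (suc j)) ⟩
    W * ((m + suc j) * F (suc j))                  ∎)
    where
    open ≤-Reasoning
    lem₁ : ∀ W j m f → W * (j * (2 * m * f)) ≡ m * (2 * (j * W) * f)
    lem₁ = solve-∀
    lem₂ : ∀ m W j f → m * ((W + 5 * j) * f) ≡ (W * m + 5 * m * j) * f
    lem₂ = solve-∀
    lem₃ : ∀ W m j f → (W * m + W * j) * f ≡ W * ((m + j) * f)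
    lem₃ = solve-∀

  term-bound : ∀ j → F (suc j) * suc b ^ j ≤ F 1 * multichoose m j
  term-bound zero    = ≤-refl
  term-bound (suc j) = *-cancelˡ-≤ (suc j) (begin
    suc j * (F (suc (suc j)) * suc b ^ suc j)             ≡⟨ lem₁ (suc j) (F (suc (suc j))) (suc b) (suc b ^ j) ⟩
    suc j * (suc b * F (suc (suc j))) * suc b ^ j         ≤⟨ *-monoˡ-≤ (suc b ^ j) (step′ j) ⟩
    (m + suc j) * F (suc j) * suc b ^ j                   ≡⟨ *-assoc (m + suc j) (F (suc j)) (suc b ^ j) ⟩
    (m + suc j) * (F (suc j) * suc b ^ j)                 ≤⟨ *-monoʳ-≤ (m + suc j) (term-bound j) ⟩
    (m + suc j) * (F 1 * multichoose m j)                 ≡⟨ lem₂ (m + suc j) (F 1) (multichoose m j) ⟩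
    F 1 * ((m + suc j) * multichoose m j)                 ≡⟨ cong (F 1 *_) (multichoose-absorb m j) ⟨
    F 1 * (suc j * multichoose m (suc j))                 ≡⟨ lem₂ (F 1) (suc j) (multichoose m (suc j)) ⟩
    suc j * (F 1 * multichoose m (suc j))                 ∎)
    where
    open ≤-Reasoning
    lem₁ : ∀ j f b p → j * (f * (b * p)) ≡ j * (b * f) * p
    lem₁ = solve-∀
    lem₂ : ∀ x y z → x * (y * z) ≡ y * (x * z)
    lem₂ = solve-∀

  sum-bound : ∀ N → sumUpTo N (F ∘ suc) * suc b ^ N ≤ F 1 * (suc b * partialSeries b m N)
  sum-bound zero    = z≤n
  sum-bound (suc N) = begin
    (sumUpTo N (F ∘ suc) + F (suc N)) * suc b ^ suc N
      ≡⟨ lem₁ (sumUpTo N (F ∘ suc)) (F (suc N)) (suc b) (suc b ^ N) ⟩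
    suc b * (sumUpTo N (F ∘ suc) * suc b ^ N) + suc b * (F (suc N) * suc b ^ N)
      ≤⟨ +-mono-≤ (*-monoʳ-≤ (suc b) (sum-bound N)) (*-monoʳ-≤ (suc b) (term-bound N)) ⟩
    suc b * (F 1 * (suc b * partialSeries b m N)) + suc b * (F 1 * multichoose m N)
      ≡⟨ lem₂ (F 1) (suc b) (partialSeries b m N) (multichoose m N) ⟩
    F 1 * (suc b * (suc b * partialSeries b m N + multichoose m N)) ∎
    where
    open ≤-Reasoning
    lem₁ : ∀ s f b p → (s + f) * (b * p) ≡ b * (s * p) + b * (f * p)
    lem₁ = solve-∀
    lem₂ : ∀ f b x c → b * (f * (b * x)) + b * (f * c) ≡ f * (b * (b * x + c))
    lem₂ = solve-∀

  total-bound : ∀ N → sumUpTo N (F ∘ suc) * b ^ suc m ≤ F 1 * suc b ^ suc m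
  total-bound N = *-cancelʳ-≤ _ _ (suc b ^ N) ⦃ m^n≢0 (suc b) N ⦄ (begin
    sumUpTo N (F ∘ suc) * b ^ suc m * suc b ^ N           ≡⟨ lem₁ (sumUpTo N (F ∘ suc)) (b ^ suc m) (suc b ^ N) ⟩
    b ^ suc m * (sumUpTo N (F ∘ suc) * suc b ^ N)         ≤⟨ *-monoʳ-≤ (b ^ suc m) (sum-bound N) ⟩
    b ^ suc m * (F 1 * (suc b * partialSeries b m N))     ≡⟨ lem₂ (b ^ suc m) (F 1) (suc b) (partialSeries b m N) ⟩
    F 1 * (suc b * (b ^ suc m * partialSeries b m N))     ≤⟨ *-monoʳ-≤ (F 1) (*-monoʳ-≤ (suc b) (partialSeries-bound b m N)) ⟩
    F 1 * (suc b * suc b ^ (m + N))                       ≡⟨ cong (F 1 *_) (^-distribˡ-+-* (suc b) (suc m) N) ⟩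
    F 1 * (suc b ^ suc m * suc b ^ N)                     ≡⟨ *-assoc (F 1) (suc b ^ suc m) (suc b ^ N) ⟨
    F 1 * suc b ^ suc m * suc b ^ N                       ∎)
    where
    open ≤-Reasoning
    lem₁ : ∀ s p q → s * p * q ≡ p * (s * q)
    lem₁ = solve-∀
    lem₂ : ∀ p f b x → p * (f * (b * x)) ≡ f * (b * (p * x))
    lem₂ = solve-∀

-- Sizes of the class and of its connected part

sumUpTo-≡ᵇ : ∀ N k → k ℕ.< N → 1 ≤ sumUpTo N (λ j → 𝟙 (k ≡ᵇ j))
sumUpTo-≡ᵇ (suc N) k (s≤s k≤N) with k ℕ.≟ N
... | yes refl = ≤-trans (≤-reflexive (cong 𝟙 (sym (T⇒≡true (≡⇒≡ᵇ k k refl))))) (m≤n+m _ (sumUpTo N (λ j → 𝟙 (k ≡ᵇ j))))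
... | no k≢N   = ≤-trans (sumUpTo-≡ᵇ N k (≤∧≢⇒< k≤N k≢N)) (m≤m+n _ _)

sumUpTo-∑ : ∀ {A : Set} (xs : List A) N (f : ℕ → A → ℕ) →
  sumUpTo N (λ j → ∑ xs (f j)) ≡ ∑[ x ∈ xs ] sumUpTo N (λ j → f j x)
sumUpTo-∑ xs zero    f = sym (∑-zero xs)
sumUpTo-∑ xs (suc N) f = trans (cong (_+ ∑ xs (f N)) (sumUpTo-∑ xs N f)) (sym (∑-+ xs _ _))

length-simpleGraphs : ∀ {W} (p : Graph W → Bool) →
  length (filterᵇ p (simpleGraphs W)) ≡ ∑[ G ∈ allGraphs W ] 𝟙 (isSimple G ∧ p G)
length-simpleGraphs {W} p = trans (length-filterᵇ p (simpleGraphs W)) (trans (∑-filterᵇ isSimple (allGraphs W) _)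
  (∑-cong (allGraphs W) λ G → sym (𝟙-∧ (isSimple G) (p G))))

one-class : ∀ {W} {r : Fin W → Fin W → Bool} → Equiv r → classCount r ≡ 1 → ∀ u v → r u v ≡ true
one-class {W} {r} E count u v with r u v in uv
... | true  = refl
... | false with ∃-least E (suc (toℕ v)) v ≤-refl
...   | a , va , la = ⊥-elim (1+n≰n (begin
  1                                                      ≡⟨ cong₂ (λ s t → 𝟙 s * 𝟙 (not t)) la (trans (sym (tranʳ va u)) uv) ⟨
  𝟙 (isLeast r a) * 𝟙 (not (r u a))                      ≤⟨ ∑ⱽ-≥ (λ a → 𝟙 (isLeast r a) * 𝟙 (not (r u a))) a ⟩
  ∑ⱽ[ a ] (𝟙 (isLeast r a) * 𝟙 (not (r u a)))            ≡⟨ suc-injective (trans (sym (∑-otherLeast E u)) count) ⟩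
  0                                                      ∎))
  where
  open ≤-Reasoning
  open Equiv E

module _ {W} (v₀ : Fin W) (𝒜 : Class W) (alterable : BridgeAlterable 𝒜) where
  open Levels 𝒜 alterable

  -- The number of components lies between 1 and `W`: the class of `v₀` is one, and each class has
  -- its own least vertex. Hence the `W` levels starting from 1 exhaust the class.
  size≤levels : size 𝒜 ≤ sumUpTo W (levelSize ∘ suc)
  size≤levels = begin
    size 𝒜                                                             ≡⟨ length-simpleGraphs 𝒜 ⟩
    ∑[ G ∈ allGraphs W ] 𝟙 (isSimple G ∧ 𝒜 G)                     ≤⟨ ∑-mono (allGraphs W) point ⟩
    ∑[ G ∈ allGraphs W ] sumUpTo W (λ j → 𝟙 (inLevel (suc j) G))
      ≡⟨ sumUpTo-∑ (allGraphs W) W _ ⟨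
    sumUpTo W (levelSize ∘ suc)                                   ∎
    where
    open ≤-Reasoning
    sumUpTo-cong : ∀ N {f g : ℕ → ℕ} → (∀ j → f j ≡ g j) → sumUpTo N f ≡ sumUpTo N g
    sumUpTo-cong zero    h = refl
    sumUpTo-cong (suc N) h = cong₂ _+_ (sumUpTo-cong N h) (h N)
    point : ∀ G → 𝟙 (isSimple G ∧ 𝒜 G) ≤ sumUpTo W (λ j → 𝟙 (inLevel (suc j) G))
    point G with isSimple G in s | 𝒜 G
    ... | false | _     = z≤n
    ... | true  | false = z≤n
    ... | true  | true  = ≤-trans (sumUpTo-≡ᵇ W k k<W)
        (≤-reflexive (sumUpTo-cong W λ j → cong (λ c → 𝟙 (c ≡ᵇ suc j)) (sym count)))
      where
      k : ℕ
      k = ∑ⱽ[ a ] (𝟙 (isLeast (reachable G) a) * 𝟙 (not (reachable G v₀ a)))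
      count : components G ≡ suc k
      count = trans (components≡classCount G) (∑-otherLeast (reachable-equiv (isSimple⇒Simple G s)) v₀)
      k<W : k ℕ.< W
      k<W = ≤-trans (≤-reflexive (sym (trans (sym (components≡classCount G)) count))) (∑ⱽ-𝟙≤W (isLeast (reachable G)))

  levelSize-1≤connected : levelSize 1 ≤ connectedCount 𝒜
  levelSize-1≤connected = ≤-trans (∑-mono (allGraphs W) point) (≤-reflexive (sym (length-simpleGraphs (λ G → 𝒜 G ∧ isConnected G))))
    where
    point : ∀ G → 𝟙 (inLevel 1 G) ≤ 𝟙 (isSimple G ∧ (𝒜 G ∧ isConnected G))
    point G with inLevel 1 G in e
    ... | false = z≤n
    ... | true  = ≤-reflexive (cong 𝟙 (sym (∧-intro (proj₁ split) (∧-intro (proj₁ (∧-split {𝒜 G} (proj₂ split))) connected))))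
      where
      split = ∧-split {isSimple G} e
      connected : isConnected G ≡ true
      connected = allᶠ⁺ _ λ u → allᶠ⁺ _ λ v → one-class (reachable-equiv (isSimple⇒Simple G (proj₁ split)))
        (inLevel⇒classCount {1} {G} e) u v

  connected-bound : ∀ m b → 2 * m ≡ suc b → 5 * m ≤ W → size 𝒜 * b ^ suc m ≤ connectedCount 𝒜 * suc b ^ suc m
  connected-bound m b 2m≡1+b 5m≤W = begin
    size 𝒜 * b ^ suc m                                   ≤⟨ *-monoˡ-≤ (b ^ suc m) size≤levels ⟩
    sumUpTo W (levelSize ∘ suc) * b ^ suc m        ≤⟨ total-bound levelSize W level-step m b 2m≡1+b 5m≤W (nonZero v₀) W ⟩
    levelSize 1 * suc b ^ suc m                          ≤⟨ *-monoˡ-≤ (suc b ^ suc m) levelSize-1≤connected ⟩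
    connectedCount 𝒜 * suc b ^ suc m                     ∎
    where
    open ≤-Reasoning
    nonZero : ∀ {n} → Fin n → ℕ.NonZero n
    nonZero {suc n} _ = _

nonEmpty-size : ∀ {W} {𝒜 : Class W} → NonEmpty 𝒜 → 1 ≤ size 𝒜
nonEmpty-size {W} {𝒜} (G , s , a) = ≤-trans (≤-reflexive (cong 𝟙 (sym (∧-intro s a))))
  (≤-trans (allGraphs-≥ (λ G → 𝟙 (isSimple G ∧ 𝒜 G)) G) (≤-reflexive (sym (length-simpleGraphs 𝒜))))
  where
  allVecs-≥ : ∀ {A : Set} (xs : List A) → (∀ f x → f x ≤ ∑ xs f) → ∀ {n} f (v : Vec A n) → f v ≤ ∑ (allVecs xs n) f
  allVecs-≥ xs h f []      = m≤m+n _ _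
  allVecs-≥ xs h f (x ∷ v) = begin
    f (x ∷ v)                                            ≤⟨ allVecs-≥ xs h (f ∘ (x ∷_)) v ⟩
    ∑ (allVecs xs _) (f ∘ (x ∷_))                        ≡⟨ ∑-map (x ∷_) (allVecs xs _) f ⟨
    ∑ (map (x ∷_) (allVecs xs _)) f                      ≤⟨ h (λ x → ∑ (map (x ∷_) (allVecs xs _)) f) x ⟩
    ∑[ x ∈ xs ] ∑ (map (x ∷_) (allVecs xs _)) f          ≡⟨ ∑-concatMap _ xs f ⟨
    ∑ (allVecs xs _) f                                   ∎
    where open ≤-Reasoning
  allGraphs-≥ : (f : Graph W → ℕ) (G : Graph W) → f G ≤ ∑ (allGraphs W) f
  allGraphs-≥ = allVecs-≥ _ (allVecs-≥ _ bool-≥)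
    where
    bool-≥ : (f : Bool → ℕ) (x : Bool) → f x ≤ ∑ (true ∷ false ∷ []) f
    bool-≥ f true  = m≤m+n _ _
    bool-≥ f false = ≤-trans (m≤m+n _ 0) (m≤n+m _ (f true))

-- Rational estimates

frac : ℕ → (d : ℕ) .⦃ _ : ℕ.NonZero d ⦄ → ℚ
frac n d = (ℤ.+ n) / d

toℚᵘ-frac : ∀ n d → toℚᵘ (frac n (suc d)) ≃ᵘ mkℚᵘ (ℤ.+ n) d
toℚᵘ-frac n d = toℚᵘ-fromℚᵘ (mkℚᵘ (ℤ.+ n) d)

frac-≤ : ∀ a c m n → a * suc n ≤ c * suc m → frac a (suc m) ≤ℚ frac c (suc n)
frac-≤ a c m n h = toℚᵘ-cancel-≤ (ℚᵘP.≤-respˡ-≃ (ℚᵘP.≃-sym (toℚᵘ-frac a m)) (ℚᵘP.≤-respʳ-≃ (ℚᵘP.≃-sym (toℚᵘ-frac c n))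
  (*≤* (subst₂ ℤ._≤_ (ℤP.pos-* a (suc n)) (ℤP.pos-* c (suc m)) (ℤ.+≤+ h)))))

frac-≡ : ∀ a c m n → a * suc n ≡ c * suc m → frac a (suc m) ≡ frac c (suc n)
frac-≡ a c m n h = ℚP.≤-antisym (frac-≤ a c m n (≤-reflexive h)) (frac-≤ c a n m (≤-reflexive (sym h)))

frac-* : ∀ a c m n → frac a (suc m) *ℚ frac c (suc n) ≡ frac (a * c) (suc m * suc n)
frac-* a c m n = toℚᵘ-injective (ℚᵘP.≃-trans (toℚᵘ-homo-* (frac a (suc m)) (frac c (suc n)))
  (ℚᵘP.≃-trans (ℚᵘP.*-cong (toℚᵘ-frac a m) (toℚᵘ-frac c n))
  (ℚᵘP.≃-trans (ℚᵘP.≃-reflexive (cong (λ z → mkℚᵘ z (n + m * suc n)) (sym (ℤP.pos-* a c)))) (ℚᵘP.≃-sym (toℚᵘ-frac (a * c) (n + m * suc n))))))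

frac-+ : ∀ a c m n → frac a (suc m) +ℚ frac c (suc n) ≡ frac (a * suc n + c * suc m) (suc m * suc n)
frac-+ a c m n = toℚᵘ-injective (ℚᵘP.≃-trans (toℚᵘ-homo-+ (frac a (suc m)) (frac c (suc n)))
  (ℚᵘP.≃-trans (ℚᵘP.+-cong (toℚᵘ-frac a m) (toℚᵘ-frac c n))
  (ℚᵘP.≃-trans (ℚᵘP.≃-reflexive (cong (λ z → mkℚᵘ z (n + m * suc n))
      (cong₂ ℤ._+_ (sym (ℤP.pos-* a (suc n))) (sym (ℤP.pos-* c (suc m))))))
    (ℚᵘP.≃-sym (toℚᵘ-frac (a * suc n + c * suc m) (n + m * suc n))))))

frac≥0 : ∀ a m → 0ℚ ≤ℚ frac a (suc m)
frac≥0 a m = frac-≤ 0 a 0 m z≤n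

*ℚ-mono : ∀ {r p q} → 0ℚ ≤ℚ r → p ≤ℚ q → r *ℚ p ≤ℚ r *ℚ q
*ℚ-mono {r} 0≤r = ℚP.*-monoˡ-≤-nonNeg r ⦃ ℚ.nonNegative 0≤r ⦄

*ℚ-monoʳ : ∀ {r p q} → 0ℚ ≤ℚ r → p ≤ℚ q → p *ℚ r ≤ℚ q *ℚ r
*ℚ-monoʳ {r} 0≤r = ℚP.*-monoʳ-≤-nonNeg r ⦃ ℚ.nonNegative 0≤r ⦄

*ℚ≥0 : ∀ {p q} → 0ℚ ≤ℚ p → 0ℚ ≤ℚ q → 0ℚ ≤ℚ p *ℚ q
*ℚ≥0 {p} 0≤p 0≤q = ℚP.≤-trans (ℚP.≤-reflexive (sym (ℚP.*-zeroʳ p))) (*ℚ-mono 0≤p 0≤q)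

*ℚ≤ : ∀ {p q} → p ≤ℚ 1ℚ → 0ℚ ≤ℚ q → p *ℚ q ≤ℚ q
*ℚ≤ p≤1 0≤q = ℚP.≤-trans (*ℚ-monoʳ 0≤q p≤1) (ℚP.≤-reflexive (ℚP.*-identityˡ _))

+ℚ≥0 : ∀ {p q} → 0ℚ ≤ℚ p → 0ℚ ≤ℚ q → 0ℚ ≤ℚ p +ℚ q
+ℚ≥0 = ℚP.+-mono-≤

≤-by : ∀ {p q d} → 0ℚ ≤ℚ d → q ≡ p +ℚ d → p ≤ℚ q
≤-by {p} 0≤d refl = ℚP.≤-trans (ℚP.≤-reflexive (sym (ℚP.+-identityʳ p))) (ℚP.+-monoʳ-≤ p 0≤d)

gap≥0 : ∀ {p q} → p ≤ℚ q → 0ℚ ≤ℚ q - p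
gap≥0 {p} p≤q = ℚP.≤-trans (ℚP.≤-reflexive (sym (ℚP.+-inverseʳ p))) (ℚP.+-monoˡ-≤ (ℚ.- p) p≤q)

_^ℚ_ : ℚ → ℕ → ℚ
x ^ℚ zero  = 1ℚ
x ^ℚ suc n = x *ℚ x ^ℚ n

infixr 8 _^ℚ_

^ℚ-+ : ∀ x m n → x ^ℚ (m + n) ≡ x ^ℚ m *ℚ x ^ℚ n
^ℚ-+ x zero    n = sym (ℚP.*-identityˡ _)
^ℚ-+ x (suc m) n = trans (cong (x *ℚ_) (^ℚ-+ x m n)) (sym (ℚP.*-assoc x _ _))

^ℚ≥0 : ∀ {x} → 0ℚ ≤ℚ x → ∀ n → 0ℚ ≤ℚ x ^ℚ n
^ℚ≥0 0≤x zero    = frac≥0 1 0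
^ℚ≥0 0≤x (suc n) = *ℚ≥0 0≤x (^ℚ≥0 0≤x n)

recip : ℕ → ℚ
recip n = frac 1 (suc n)

recip≥0 : ∀ n → 0ℚ ≤ℚ recip n
recip≥0 n = frac≥0 1 n

recip≤1 : ∀ n → recip n ≤ℚ 1ℚ
recip≤1 n = frac-≤ 1 1 n 0 (s≤s z≤n)

-- The algebraic relation between neighbouring reciprocals, to be substituted by hand where the ring
-- solver sees them as independent variables.
recip-suc : ∀ n → recip n ≡ recip (suc n) *ℚ (1ℚ +ℚ recip n)
recip-suc n = sym (trans (cong (recip (suc n) *ℚ_) (frac-+ 1 1 0 n))
  (trans (frac-* 1 (1 * suc n + 1 * 1) (suc n) (n + 0)) (frac-≡ (1 * (1 * suc n + 1 * 1)) 1 (n + 0 + suc n * suc (n + 0)) n (lem n))))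
  where
  lem : ∀ n → 1 * (1 * suc n + 1 * 1) * suc n ≡ 1 * (suc (suc n) * suc (n + 0))
  lem = solve-∀

-- Convexity of the odd Taylor polynomials of the exponential

-- expTerm x n = xⁿ/n!
expTerm : ℚ → ℕ → ℚ
expTerm x zero    = 1ℚ
expTerm x (suc n) = recip n *ℚ (x *ℚ expTerm x n)

-- expNeg x n = Σ_{i≤2n+1} (−x)ⁱ/i!
expNeg : ℚ → ℕ → ℚ
expNeg x zero    = 1ℚ - x
expNeg x (suc n) = expNeg x n +ℚ (expTerm x (suc (suc (n + n))) - expTerm x (suc (suc (suc (n + n)))))

expTerm≥0 : ∀ {x} → 0ℚ ≤ℚ x → ∀ n → 0ℚ ≤ℚ expTerm x n
expTerm≥0 0≤x zero    = frac≥0 1 0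
expTerm≥0 0≤x (suc n) = *ℚ≥0 (recip≥0 n) (*ℚ≥0 0≤x (expTerm≥0 0≤x n))

module Tangent {x h : ℚ} (0≤x : 0ℚ ≤ℚ x) (0≤h : 0ℚ ≤ℚ h) (x+h≤1 : x +ℚ h ≤ℚ 1ℚ) where
  open +-*-Solver

  y : ℚ
  y = x +ℚ h

  0≤y : 0ℚ ≤ℚ y
  0≤y = +ℚ≥0 0≤x 0≤h

  x≤1 : x ≤ℚ 1ℚ
  x≤1 = ℚP.≤-trans (≤-by 0≤h refl) x+h≤1

  -- How far the value at x of xᵏ⁺¹/(k+1)! lies above its tangent at y.
  excess : ℕ → ℚ
  excess k = expTerm x (suc k) - expTerm y (suc k) +ℚ h *ℚ expTerm y k

  -- Multiplying by the variable and dividing by k + 2 carries the tangent of one power to that of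
  -- the next, with a new second-order term in h². Both summands are non-negative, which gives
  -- `excess≥0` by induction.
  excess-suc : ∀ k → excess (suc k) ≡ recip (suc k) *ℚ (x *ℚ excess k +ℚ h *ℚ h *ℚ expTerm y k)
  excess-suc k = trans (cong (λ c → r′ *ℚ (x *ℚ X) - r′ *ℚ (y *ℚ Y) +ℚ h *ℚ (c *ℚ (y *ℚ E))) (recip-suc k))
    (solve 6 (λ x h r r′ X E →
       r′ :* (x :* X) :- r′ :* ((x :+ h) :* (r :* ((x :+ h) :* E))) :+ h :* (r′ :* (con 1ℚ :+ r) :* ((x :+ h) :* E))
       := r′ :* (x :* (X :- r :* ((x :+ h) :* E) :+ h :* E) :+ h :* h :* E)) refl x h (recip k) r′ X E)
    where
    r′ X Y E : ℚ
    r′ = recip (suc k)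
    X  = expTerm x (suc k)
    Y  = expTerm y (suc k)
    E  = expTerm y k

  excess≥0 : ∀ k → 0ℚ ≤ℚ excess k
  excess≥0 zero = ℚP.≤-reflexive (solve 2 (λ x h →
    con 0ℚ := con 1ℚ :* (x :* con 1ℚ) :- con 1ℚ :* ((x :+ h) :* con 1ℚ) :+ h :* con 1ℚ) refl x h)
  excess≥0 (suc k) = ℚP.≤-trans
    (*ℚ≥0 (recip≥0 (suc k)) (+ℚ≥0 (*ℚ≥0 0≤x (excess≥0 k)) (*ℚ≥0 (*ℚ≥0 0≤h 0≤h) (expTerm≥0 0≤y k))))
    (ℚP.≤-reflexive (sym (excess-suc k)))

  -- The convexity of the polynomial in disguise: it lets each even term minus the following odd
  -- term lie above its own tangent. Here the restriction to [0,1] is used.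
  excess-decreasing : ∀ k → excess (suc (suc k)) ≤ℚ excess (suc k)
  excess-decreasing k = begin
    excess (suc (suc k))                        ≡⟨ excess-suc (suc k) ⟩
    r′ *ℚ (x *ℚ a +ℚ h *ℚ h *ℚ expTerm y (suc k))
      ≤⟨ *ℚ-mono (recip≥0 (suc (suc k))) (ℚP.+-mono-≤ (*ℚ≤ x≤1 (excess≥0 (suc k)))
           (*ℚ-mono (*ℚ≥0 0≤h 0≤h) (ℚP.≤-trans (*ℚ≤ (recip≤1 k) (*ℚ≥0 0≤y (expTerm≥0 0≤y k)))
             (*ℚ≤ x+h≤1 (expTerm≥0 0≤y k))))) ⟩
    r′ *ℚ (a +ℚ Z)
      ≤⟨ ≤-by (*ℚ≥0 (gap≥0 (recip≤1 (suc (suc k)))) (gap≥0 rZ≤a)) (trans split (cong (λ c → r′ *ℚ (a +ℚ Z) +ℚ (1ℚ - r′) *ℚ (a - c *ℚ Z)) (sym (recip-suc (suc k))))) ⟩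
    a                                           ∎
    where
    open ℚP.≤-Reasoning
    r r′ a Z : ℚ
    r  = recip (suc k)
    r′ = recip (suc (suc k))
    a  = excess (suc k)
    Z  = h *ℚ h *ℚ expTerm y k
    rZ≤a : r *ℚ Z ≤ℚ a
    rZ≤a = ≤-by (*ℚ≥0 (recip≥0 (suc k)) (*ℚ≥0 0≤x (excess≥0 k))) (trans (excess-suc k)
      (solve 3 (λ r u z → r :* (u :+ z) := r :* z :+ r :* u) refl r (x *ℚ excess k) Z))
    split : a ≡ r′ *ℚ (a +ℚ Z) +ℚ (1ℚ - r′) *ℚ (a - r′ *ℚ (1ℚ +ℚ r) *ℚ Z)
    split = trans (solve 3 (λ r′ a z → a := r′ :* (a :+ z) :+ (con 1ℚ :- r′) :* a :- r′ :* z) refl r′ a Z)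
      (trans (cong (λ c → r′ *ℚ (a +ℚ Z) +ℚ (1ℚ - r′) *ℚ a - c *ℚ Z) cancel)
        (solve 4 (λ r r′ a z → r′ :* (a :+ z) :+ (con 1ℚ :- r′) :* a :- (con 1ℚ :- r′) :* (r′ :* (con 1ℚ :+ r)) :* z
          := r′ :* (a :+ z) :+ (con 1ℚ :- r′) :* (a :- r′ :* (con 1ℚ :+ r) :* z)) refl r r′ a Z))
      where
      cancel : r′ ≡ (1ℚ - r′) *ℚ (r′ *ℚ (1ℚ +ℚ r))
      cancel = trans (solve 2 (λ r r′ → r′ := r′ :* (con 1ℚ :+ r) :- r′ :* r) refl r r′)
        (trans (cong (λ c → r′ *ℚ (1ℚ +ℚ r) - r′ *ℚ c) (recip-suc (suc k)))
          (solve 2 (λ r r′ → r′ :* (con 1ℚ :+ r) :- r′ :* (r′ :* (con 1ℚ :+ r)) := (con 1ℚ :- r′) :* (r′ :* (con 1ℚ :+ r))) refl r r′))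

  -- For T = `expNeg` the derivative is -(T + y^{2n+1}/(2n+1)!), the next shorter partial sum with
  -- sign reversed. So the left side is the tangent of T at `y`, evaluated at `x = y − h`; for n = 0
  -- it is T itself.
  expNeg-tangent : ∀ n → expNeg y n +ℚ h *ℚ (expNeg y n +ℚ expTerm y (suc (n + n))) ≤ℚ expNeg x n
  expNeg-tangent zero = ℚP.≤-reflexive (solve 2 (λ x h →
    con 1ℚ :- (x :+ h) :+ h :* (con 1ℚ :- (x :+ h) :+ con 1ℚ :* ((x :+ h) :* con 1ℚ)) := con 1ℚ :- x) refl x h)
  expNeg-tangent (suc n) rewrite +-suc n n = begin
    (τ +ℚ (e₂ - e₃)) +ℚ h *ℚ ((τ +ℚ (e₂ - e₃)) +ℚ e₃)
      ≡⟨ solve 5 (λ τ e₁ e₂ e₃ h → (τ :+ (e₂ :- e₃)) :+ h :* ((τ :+ (e₂ :- e₃)) :+ e₃)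
           := (τ :+ h :* (τ :+ e₁)) :+ ((e₂ :- e₃) :+ (h :* e₂ :- h :* e₁))) refl τ e₁ e₂ e₃ h ⟩
    (τ +ℚ h *ℚ (τ +ℚ e₁)) +ℚ ((e₂ - e₃) +ℚ (h *ℚ e₂ - h *ℚ e₁))
      ≤⟨ ℚP.+-mono-≤ (expNeg-tangent n) (≤-by (gap≥0 (excess-decreasing (n + n)))
           (solve 7 (λ f₂ f₃ e₁ e₂ e₃ h τ → f₂ :- f₃ := ((e₂ :- e₃) :+ (h :* e₂ :- h :* e₁)) :+ ((f₂ :- e₂ :+ h :* e₁) :- (f₃ :- e₃ :+ h :* e₂)))
             refl (expTerm x (suc (suc (n + n)))) (expTerm x (suc (suc (suc (n + n))))) e₁ e₂ e₃ h τ)) ⟩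
    expNeg x n +ℚ (expTerm x (suc (suc (n + n))) - expTerm x (suc (suc (suc (n + n))))) ∎
    where
    open ℚP.≤-Reasoning
    τ e₁ e₂ e₃ : ℚ
    τ  = expNeg y n
    e₁ = expTerm y (suc (n + n))
    e₂ = expTerm y (suc (suc (n + n)))
    e₃ = expTerm y (suc (suc (suc (n + n))))

  expNeg-step : ∀ n → (1ℚ +ℚ h) *ℚ expNeg y n ≤ℚ expNeg x n
  expNeg-step n = ℚP.≤-trans (≤-by (*ℚ≥0 0≤h (expTerm≥0 0≤y (suc (n + n))))
    (solve 3 (λ τ e h → τ :+ h :* (τ :+ e) := (con 1ℚ :+ h) :* τ :+ h :* e) refl (expNeg y n) (expTerm y (suc (n + n))) h))
    (expNeg-tangent n)

expTerm-0 : ∀ n → expTerm 0ℚ (suc n) ≡ 0ℚ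
expTerm-0 n = trans (cong (recip n *ℚ_) (ℚP.*-zeroˡ (expTerm 0ℚ n))) (ℚP.*-zeroʳ (recip n))

expNeg-0 : ∀ n → expNeg 0ℚ n ≡ 1ℚ
expNeg-0 zero    = refl
expNeg-0 (suc n) = cong₂ _+ℚ_ (expNeg-0 n) (cong₂ _-_ (expTerm-0 (suc (n + n))) (expTerm-0 (suc (suc (n + n)))))

module _ (q : ℕ) where
  private
    b : ℕ
    b = suc q

    Y h : ℚ
    Y = frac b (suc b)
    h = frac 1 b

    Y*[1+h]≡1 : Y *ℚ (1ℚ +ℚ h) ≡ 1ℚ
    Y*[1+h]≡1 = trans (cong (Y *ℚ_) (frac-+ 1 1 0 q)) (trans (frac-* b (1 * b + 1 * 1) b (q + 0))
      (frac-≡ (b * (1 * b + 1 * 1)) 1 (q + 0 + b * suc (q + 0)) 0 (lem q)))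
      where
      lem : ∀ q → suc q * (1 * suc q + 1 * 1) * 1 ≡ 1 * (suc (suc q) * suc (q + 0))
      lem = solve-∀

    advance : ∀ k → frac k b +ℚ h ≡ frac (suc k) b
    advance k = trans (frac-+ k 1 q q) (frac-≡ (k * b + 1 * b) (suc k) (q + q * suc q) q (lem k q))
      where
      lem : ∀ k q → (k * suc q + 1 * suc q) * suc q ≡ suc k * (suc q * suc q)
      lem = solve-∀

  -- Each step of length `h = 1/b` costs a factor 1/(1 + h) = `Y`, starting from the value 1 at 0.
  -- It is the discrete form of (1 + 1/b)^b ≤ e.
  expNeg-bound : ∀ n k → k ≤ b → expNeg (frac k b) n ≤ℚ Y ^ℚ k
  expNeg-bound n zero    _ = ℚP.≤-reflexive (trans (cong (λ z → expNeg z n) (frac-≡ 0 0 q 0 refl)) (expNeg-0 n))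
  expNeg-bound n (suc k) k<b = begin
    expNeg (frac (suc k) b) n                       ≡⟨ cong (λ z → expNeg z n) (advance k) ⟨
    τ                                               ≡⟨ trans (cong (_*ℚ τ) Y*[1+h]≡1) (ℚP.*-identityˡ τ) ⟨
    Y *ℚ (1ℚ +ℚ h) *ℚ τ                             ≡⟨ ℚP.*-assoc Y (1ℚ +ℚ h) τ ⟩
    Y *ℚ ((1ℚ +ℚ h) *ℚ τ)                           ≤⟨ *ℚ-mono (frac≥0 b b) (Tangent.expNeg-step (frac≥0 k q) (frac≥0 1 q)
                                                        (ℚP.≤-trans (ℚP.≤-reflexive (advance k))
                                                          (frac-≤ (suc k) 1 q 0 (≤-trans (≤-reflexive (*-identityʳ (suc k))) (≤-trans k<b (≤-reflexive (sym (*-identityˡ b))))))) n) ⟩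
    Y *ℚ expNeg (frac k b) n                        ≤⟨ *ℚ-mono (frac≥0 b b) (expNeg-bound n k (<⇒≤ k<b)) ⟩
    Y *ℚ Y ^ℚ k                                     ∎
    where
    open ℚP.≤-Reasoning
    τ : ℚ
    τ = expNeg (frac k b +ℚ h) n

  expNeg-1-bound : ∀ n → expNeg 1ℚ n ≤ℚ Y ^ℚ b
  expNeg-1-bound n = ℚP.≤-trans
    (ℚP.≤-reflexive (cong (λ z → expNeg z n) (frac-≡ 1 b 0 q (*-comm 1 b)))) (expNeg-bound n b ≤-refl)

-- Identification with the prescribed partial sums

alternating : ℕ → ℚ
alternating zero          = 1ℚ
alternating (suc zero)    = -[1+ 0 ] / 1
alternating (suc (suc k)) = alternating k

period-2 : (s t : ℕ → ℚ) → s 0 ≡ t 0 → s 1 ≡ t 1 →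
  (∀ k → s (suc (suc k)) ≡ s k) → (∀ k → t (suc (suc k)) ≡ t k) → ∀ k → s k ≡ t k
period-2 s t e₀ e₁ ps pt zero          = e₀
period-2 s t e₀ e₁ ps pt (suc zero)    = e₁
period-2 s t e₀ e₁ ps pt (suc (suc k)) = trans (ps k) (trans (period-2 s t e₀ e₁ ps pt k) (sym (pt k)))

-- The sign function local to expNeg1Partial cannot be named. Abstracting suc p turns it into a function
-- of a variable k, and the type of expNeg1Partial-suc′ is then left to unification.
mutual
  expNeg1Partial-suc : ∀ p → expNeg1Partial (suc p) ≡ expNeg1Partial p +ℚ (alternating (suc p) *ℚ invFact (suc p))
  expNeg1Partial-suc p with suc p | (ℤ.+ 1) / suc p
  ... | k | f = expNeg1Partial-suc′ p f k

  expNeg1Partial-suc′ : ∀ p f k → _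
  expNeg1Partial-suc′ p f = period-2 _ _ refl refl (λ _ → refl) (λ _ → refl)

expTerm-1 : ∀ n → expTerm 1ℚ n ≡ invFact n
expTerm-1 zero    = refl
expTerm-1 (suc n) = trans (cong (recip n *ℚ_) (trans (ℚP.*-identityˡ _) (expTerm-1 n))) (ℚP.*-comm (recip n) (invFact n))

alternating-even : ∀ n → alternating (n + n) ≡ 1ℚ
alternating-even zero    = refl
alternating-even (suc n) rewrite +-suc n n = alternating-even n

alternating-odd : ∀ n → alternating (suc (n + n)) ≡ ℚ.- 1ℚ
alternating-odd zero    = refl
alternating-odd (suc n) rewrite +-suc n n = alternating-odd n

expNeg-1 : ∀ n → expNeg 1ℚ n ≡ expNeg1Partial (suc (n + n))
expNeg-1 zero    = refl
expNeg-1 (suc n) rewrite +-suc n n = sym (begin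
  expNeg1Partial (suc (suc (suc (n + n))))
    ≡⟨ trans (expNeg1Partial-suc (suc (suc (n + n)))) (cong (_+ℚ a₃ *ℚ f₃) (expNeg1Partial-suc (suc (n + n)))) ⟩
  expNeg1Partial (suc (n + n)) +ℚ a₂ *ℚ f₂ +ℚ a₃ *ℚ f₃
    ≡⟨ cong₂ (λ s t → expNeg1Partial (suc (n + n)) +ℚ s *ℚ f₂ +ℚ t *ℚ f₃) (alternating-even n) (alternating-odd n) ⟩
  expNeg1Partial (suc (n + n)) +ℚ 1ℚ *ℚ f₂ +ℚ (ℚ.- 1ℚ) *ℚ f₃
    ≡⟨ solve 3 (λ p f g → p :+ con 1ℚ :* f :+ (:- con 1ℚ) :* g := p :+ (f :- g)) refl (expNeg1Partial (suc (n + n))) f₂ f₃ ⟩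
  expNeg1Partial (suc (n + n)) +ℚ (f₂ - f₃)
    ≡⟨ cong₂ _+ℚ_ (expNeg-1 n) (cong₂ _-_ (expTerm-1 (suc (suc (n + n)))) (expTerm-1 (suc (suc (suc (n + n)))))) ⟨
  expNeg 1ℚ n +ℚ (expTerm 1ℚ (suc (suc (n + n))) - expTerm 1ℚ (suc (suc (suc (n + n))))) ∎)
  where
  open ≡-Reasoning
  open +-*-Solver
  a₂ a₃ f₂ f₃ : ℚ
  a₂ = alternating (suc (suc (n + n)))
  a₃ = alternating (suc (suc (suc (n + n))))
  f₂ = invFact (suc (suc (n + n)))
  f₃ = invFact (suc (suc (suc (n + n))))

-- Powers of b/(b+1), the constants and the conclusion

^ℚ-frac : ∀ b k → ∃ λ D → (suc D ≡ suc b ^ k) × (frac b (suc b) ^ℚ k ≡ frac (b ^ k) (suc D))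
^ℚ-frac b zero    = 0 , refl , refl
^ℚ-frac b (suc k) with ^ℚ-frac b k
... | D , eq , ih = D + b * suc D , cong (suc b *_) eq ,
  trans (cong (frac b (suc b) *ℚ_) ih) (frac-* b (b ^ k) b D)

ratio-bound : ∀ b k C S → 1 ≤ S → S * b ^ k ≤ C * suc b ^ k → (frac b (suc b) ^ℚ k ≤ℚ ratio C S) × (0ℚ ≤ℚ ratio C S)
ratio-bound b k C (suc S) _ h with ^ℚ-frac b k
... | D , eq , e = ℚP.≤-trans (ℚP.≤-reflexive e) (frac-≤ (b ^ k) C D S (begin
    b ^ k * suc S        ≡⟨ *-comm (b ^ k) (suc S) ⟩
    suc S * b ^ k        ≤⟨ h ⟩
    C * suc b ^ k        ≡⟨ cong (C *_) eq ⟨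
    C * suc D            ∎)) , frac≥0 C S
  where open ≤-Reasoning

1/denominator≤ : ∀ ε → ℚ.Positive ε → frac 1 (suc (ℚ.denominator-1 ε)) ≤ℚ ε
1/denominator≤ ε@(mkℚ (ℤ.+ suc n) d _) _ = ℚP.≤-trans (frac-≤ 1 (suc n) d d (*-monoˡ-≤ (suc d) {1} {suc n} (s≤s z≤n)))
  (ℚP.≤-reflexive (ℚP.↥p/↧p≡p ε))

-- Bernoulli's inequality with its remainder: for z = 1/(b + 1), (1 - z)³ = (1 - ε) + (ε - 3z) +
-- z²(2 + (1 - z)), and all summands after the first are non-negative.
1-ε≤cube : ∀ {ε} b → frac 3 1 *ℚ frac 1 (suc b) ≤ℚ ε → 1ℚ - ε ≤ℚ frac b (suc b) ^ℚ 3
1-ε≤cube {ε} b 3z≤ε = ≤-by (+ℚ≥0 (gap≥0 3z≤ε) (*ℚ≥0 (*ℚ≥0 (frac≥0 1 b) (frac≥0 1 b)) (+ℚ≥0 (frac≥0 2 0) (frac≥0 b b))))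
  (trans (cong (_^ℚ 3) Y≡1-z) (trans
    (solve 2 (λ z e → (con 1ℚ :- z) :* ((con 1ℚ :- z) :* ((con 1ℚ :- z) :* con 1ℚ))
      := (con 1ℚ :- e) :+ ((e :- con (frac 3 1) :* z) :+ z :* z :* (con (frac 2 1) :+ (con 1ℚ :- z)))) refl z ε)
    (cong (λ y → (1ℚ - ε) +ℚ ((ε - frac 3 1 *ℚ z) +ℚ z *ℚ z *ℚ (frac 2 1 +ℚ y))) (sym Y≡1-z))))
  where
  open +-*-Solver
  z Y : ℚ
  z = frac 1 (suc b)
  Y = frac b (suc b)
  Y+z≡1 : Y +ℚ z ≡ 1ℚ
  Y+z≡1 = trans (frac-+ b 1 b b) (frac-≡ (b * suc b + 1 * suc b) 1 (b + b * suc b) 0 (lem b))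
    where
    lem : ∀ b → (b * suc b + 1 * suc b) * 1 ≡ 1 * suc (b + b * suc b)
    lem = solve-∀
  Y≡1-z : Y ≡ 1ℚ - z
  Y≡1-z = trans (solve 2 (λ y z → y := (y :+ z) :- z) refl Y z) (cong (_- z) Y+z≡1)

-- Applied with `suc q` = 2M - 1 and `k` = M + 1. Of the 2M + 2 factors `Y` below p², 2M - 1
-- dominate the partial sum, and the remaining three dominate a², because a² ≤ a ≤ Y³.
e^-½-bound : ∀ {a p} q k → k + k ≡ 3 + suc q → 0ℚ ≤ℚ a → a ≤ℚ 1ℚ → a ≤ℚ frac (suc q) (suc (suc q)) ^ℚ 3 →
  frac (suc q) (suc (suc q)) ^ℚ k ≤ℚ p → 0ℚ ≤ℚ p → ∀ n → a *ℚ a *ℚ expNeg1Partial (suc (n + n)) ≤ℚ p *ℚ p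
e^-½-bound {a} {p} q k k+k 0≤a a≤1 a≤Y³ Yᵏ≤p 0≤p n = begin
  a *ℚ a *ℚ expNeg1Partial (suc (n + n))   ≡⟨ cong (a *ℚ a *ℚ_) (expNeg-1 n) ⟨
  a *ℚ a *ℚ expNeg 1ℚ n                    ≤⟨ *ℚ-mono (*ℚ≥0 0≤a 0≤a) (expNeg-1-bound q n) ⟩
  a *ℚ a *ℚ Y ^ℚ suc q                     ≤⟨ *ℚ-monoʳ (^ℚ≥0 0≤Y (suc q)) (ℚP.≤-trans (*ℚ≤ a≤1 0≤a) a≤Y³) ⟩
  Y ^ℚ 3 *ℚ Y ^ℚ suc q                     ≡⟨ ^ℚ-+ Y 3 (suc q) ⟨
  Y ^ℚ (3 + suc q)                         ≡⟨ cong (Y ^ℚ_) k+k ⟨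
  Y ^ℚ (k + k)                             ≡⟨ ^ℚ-+ Y k k ⟩
  Y ^ℚ k *ℚ Y ^ℚ k                         ≤⟨ *ℚ-mono (^ℚ≥0 0≤Y k) Yᵏ≤p ⟩
  Y ^ℚ k *ℚ p                              ≤⟨ *ℚ-monoʳ 0≤p Yᵏ≤p ⟩
  p *ℚ p                                   ∎
  where
  open ℚP.≤-Reasoning
  Y : ℚ
  Y = frac (suc q) (suc (suc q))
  0≤Y : 0ℚ ≤ℚ Y
  0≤Y = frac≥0 (suc q) (suc q)

theorem1 : (ε : ℚ) → 0ℚ < ε → ∃ λ (W₀ : ℕ) → (W : ℕ) → W ≥ W₀ →
    (𝒜 : Class W) → NonEmpty 𝒜 → BridgeAlterable 𝒜 →
    (1ℚ - ε) ·e^-½≤ probConnected 𝒜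
theorem1 ε 0<ε = 5 * m , bound
  where
  d m q : ℕ
  d = ℚ.denominator-1 ε
  -- With ε ≥ 1/(d + 1), this choice gives 3/(2m) = 1/(2(d + 1)) ≤ ε, as the cube estimate requires.
  -- `q` is 2m - 2, so that the base of the powers is `suc q` = 2m - 1.
  m = 3 + 3 * d
  q = 4 + 6 * d

  2m≡2+q : 2 * m ≡ suc (suc q)
  2m≡2+q = lem d
    where
    lem : ∀ d → 2 * (3 + 3 * d) ≡ suc (suc (4 + 6 * d))
    lem = solve-∀

  3/2m≤ε : frac 3 1 *ℚ frac 1 (suc (suc q)) ≤ℚ ε
  3/2m≤ε = ℚP.≤-trans (ℚP.≤-reflexive (frac-* 3 1 0 (suc q)))
    (ℚP.≤-trans (frac-≤ 3 1 (suc q + 0) d (≤-trans (m≤m+n (3 * suc d) (3 + 3 * d)) (≤-reflexive (lem d))))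
      (1/denominator≤ ε (ℚ.positive 0<ε)))
    where
    lem : ∀ d → 3 * suc d + (3 + 3 * d) ≡ 1 * suc (suc (4 + 6 * d) + 0)
    lem = solve-∀

  bound : (W : ℕ) → W ≥ 5 * m → (𝒜 : Class W) → NonEmpty 𝒜 → BridgeAlterable 𝒜 →
    (1ℚ - ε) ·e^-½≤ probConnected 𝒜
  bound W W≥5m 𝒜 nonEmpty alterable with ℚP.≤-total (1ℚ - ε) 0ℚ
  ... | inj₁ a≤0 = inj₁ a≤0
  ... | inj₂ 0≤a = inj₂ (proj₂ p-bounds , e^-½-bound q (suc m) (lem d) 0≤a a≤1 (1-ε≤cube (suc q) 3/2m≤ε)
        (proj₁ p-bounds) (proj₂ p-bounds))
    where
    v₀ : Fin W
    v₀ = fromℕ< {0} (≤-trans (s≤s z≤n) W≥5m)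
    p-bounds : (frac (suc q) (suc (suc q)) ^ℚ suc m ≤ℚ probConnected 𝒜) × (0ℚ ≤ℚ probConnected 𝒜)
    p-bounds = ratio-bound (suc q) (suc m) (connectedCount 𝒜) (size 𝒜) (nonEmpty-size nonEmpty)
      (connected-bound v₀ 𝒜 alterable m (suc q) 2m≡2+q W≥5m)
    a≤1 : 1ℚ - ε ≤ℚ 1ℚ
    a≤1 = ≤-by (ℚP.<⇒≤ 0<ε) (solve 1 (λ e → con 1ℚ := (con 1ℚ :- e) :+ e) refl ε)
      where open +-*-Solver
    lem : ∀ d → suc (3 + 3 * d) + suc (3 + 3 * d) ≡ 3 + suc (4 + 6 * d)
    lem = solve-∀
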